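{- Let $D\ge1$, let $Q_D$ be the $D$-dimensional hypercube on $X=\{0,1\}^D$ with adjacency matrix $A$. The matrices $$\alpha^*_iA\alpha^*_j-\alpha^*_jA\alpha^*_i,\qquad 1\le i<j\le D,$$ form a basis for the space of antisymmetric $A$-like matrices of $Q_D$. In particular this space has dimension $\binom{D}{2}$.
   Context: $Q_D$ is the graph with vertex set $X=\{0,1\}^D$ (sequences $x=(x_1,\ldots,x_D)$, $x_i\in\{0,1\}$), two vertices adjacent iff they differ in exactly one coordinate. Matrices are real with rows and columns indexed by $X$. A matrix $B$ is $A$-like if $BA=AB$ and $B_{xy}=0$ for all $x,y\in X$ that are neither equal nor adjacent; $B$ is antisymmetric if $B^t=-B$. For $1\le i\le D$, $\alpha^*_i$ is the diagonal matrix with $(x,x)$-entry $1$ if $x_i=0$ and $-1$ if $x_i=1$. -}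

module Defs where

open import Algebra.Bundles using (Ring; CommutativeRing; CommutativeMonoid)
open import Algebra.Module.Bundles using (LeftModule)
import Algebra.Properties.AbelianGroup as AbelianGroupProperties
import Algebra.Properties.CommutativeSemigroup as CommutativeSemigroupProperties
import Algebra.Properties.Ring as RingProperties
open import Data.Bool.Base using (if_then_else_)
open import Data.Fin.Base as Fin using (Fin)
open import Data.Fin.Patterns using (0F; 1F)
import Data.Fin.Properties as Fin
open import Data.List.Base using (List; foldr)
open import Data.List.Membership.Propositional using (_∈_)
open import Data.List.Relation.Unary.Unique.Propositional using (Unique)
open import Data.Nat.Base as ℕ using (ℕ; zero; suc)
import Data.Nat.Properties as ℕ
open import Data.Product.Base using (∃-syntax; _×_; _,_; proj₁; proj₂)
open import Data.Product using (∃!)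
open import Data.Rational.Base as ℚ using (ℚ; 0ℚ; 1ℚ; ½; ∣_∣)
import Data.Rational.Properties as ℚ
open import Data.Rational.Solver using (module +-*-Solver)
open import Data.Vec.Base using (Vec; []; _∷_; lookup)
import Data.Vec.Properties as Vec
open import Level using (Level; _⊔_; 0ℓ) renaming (suc to lsuc)
open import Relation.Binary.PropositionalEquality using (_≡_; _≢_; refl; sym; cong; subst; module ≡-Reasoning)
open import Relation.Nullary.Decidable using (Dec; does; map′; ¬?; _×-dec_; _→-dec_)
open import Relation.Nullary.Negation using (¬_)

private
  variable
    r ℓr m ℓm p i : Level

-- Real numbers are Cauchy sequences of rationals, identified when their
-- difference is a null sequence.

Cauchy : (ℕ → ℚ) → Set
Cauchy s = ∀ ε → 0ℚ ℚ.< ε →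
  ∃[ N ] ∀ m n → N ℕ.≤ m → N ℕ.≤ n → ∣ s m ℚ.- s n ∣ ℚ.< ε

record ℝ : Set where
  constructor mkℝ
  no-eta-equality
  field
    seq    : ℕ → ℚ
    cauchy : Cauchy seq

open ℝ public

infix 4 _≈ℝ_

record _≈ℝ_ (x y : ℝ) : Set where
  constructor mk≈
  no-eta-equality
  field
    close : ∀ ε → 0ℚ ℚ.< ε →
      ∃[ N ] ∀ n → N ℕ.≤ n → ∣ seq x n ℚ.- seq y n ∣ ℚ.< ε

open _≈ℝ_ public

private
  0<½ε : ∀ {ε} → 0ℚ ℚ.< ε → 0ℚ ℚ.< ½ ℚ.* ε
  0<½ε {ε} 0<ε =
    ℚ.positive⁻¹ (½ ℚ.* ε) {{ℚ.pos*pos⇒pos ½ ε {{ℚ.positive 0<ε}}}}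

  ½ε+½ε : ∀ ε → ½ ℚ.* ε ℚ.+ ½ ℚ.* ε ≡ ε
  ½ε+½ε ε = begin
    ½ ℚ.* ε ℚ.+ ½ ℚ.* ε  ≡⟨ ℚ.*-distribʳ-+ ε ½ ½ ⟨
    1ℚ ℚ.* ε             ≡⟨ ℚ.*-identityˡ ε ⟩
    ε                    ∎
    where open ≡-Reasoning

  ∣p+q∣<ε : ∀ {ε} p q → ∣ p ∣ ℚ.< ½ ℚ.* ε → ∣ q ∣ ℚ.< ½ ℚ.* ε → ∣ p ℚ.+ q ∣ ℚ.< ε
  ∣p+q∣<ε {ε} p q p< q< = begin-strict
    ∣ p ℚ.+ q ∣          ≤⟨ ℚ.∣p+q∣≤∣p∣+∣q∣ p q ⟩
    ∣ p ∣ ℚ.+ ∣ q ∣      <⟨ ℚ.+-mono-< p< q< ⟩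
    ½ ℚ.* ε ℚ.+ ½ ℚ.* ε  ≡⟨ ½ε+½ε ε ⟩
    ε                    ∎
    where open ℚ.≤-Reasoning

  ∣p-p∣<ε : ∀ {ε} p → 0ℚ ℚ.< ε → ∣ p ℚ.- p ∣ ℚ.< ε
  ∣p-p∣<ε p 0<ε rewrite ℚ.+-inverseʳ p = 0<ε

  ∣p-q∣-comm : ∀ p q → ∣ p ℚ.- q ∣ ≡ ∣ q ℚ.- p ∣
  ∣p-q∣-comm p q = begin
    ∣ p ℚ.- q ∣          ≡⟨ ℚ.∣-p∣≡∣p∣ (p ℚ.- q) ⟨
    ∣ ℚ.- (p ℚ.- q) ∣    ≡⟨ cong ∣_∣ (solve 2 (λ a b → :- (a :- b) := b :- a) refl p q) ⟩
    ∣ q ℚ.- p ∣          ∎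
    where open ≡-Reasoning
          open +-*-Solver

  ∣p-r∣<ε : ∀ {ε} p q r → ∣ p ℚ.- q ∣ ℚ.< ½ ℚ.* ε → ∣ q ℚ.- r ∣ ℚ.< ½ ℚ.* ε →
            ∣ p ℚ.- r ∣ ℚ.< ε
  ∣p-r∣<ε {ε} p q r pq qr =
    subst (λ t → ∣ t ∣ ℚ.< ε)
      (solve 3 (λ a b c → (a :- b) :+ (b :- c) := a :- c) refl p q r)
      (∣p+q∣<ε (p ℚ.- q) (q ℚ.- r) pq qr)
    where open +-*-Solver

  +-close : ∀ {ε} a b c d → ∣ a ℚ.- c ∣ ℚ.< ½ ℚ.* ε → ∣ b ℚ.- d ∣ ℚ.< ½ ℚ.* ε →
            ∣ (a ℚ.+ b) ℚ.- (c ℚ.+ d) ∣ ℚ.< ε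
  +-close {ε} a b c d ac bd =
    subst (λ t → ∣ t ∣ ℚ.< ε)
      (solve 4 (λ a b c d → (a :- c) :+ (b :- d) := (a :+ b) :- (c :+ d)) refl a b c d)
      (∣p+q∣<ε (a ℚ.- c) (b ℚ.- d) ac bd)
    where open +-*-Solver

  neg-close : ∀ {ε} a b → ∣ a ℚ.- b ∣ ℚ.< ε → ∣ (ℚ.- a) ℚ.- (ℚ.- b) ∣ ℚ.< ε
  neg-close {ε} a b ab =
    subst (ℚ._< ε) (begin
      ∣ a ℚ.- b ∣              ≡⟨ ∣p-q∣-comm a b ⟩
      ∣ b ℚ.- a ∣              ≡⟨ cong ∣_∣ (solve 2 (λ a b → b :- a := (:- a) :- (:- b)) refl a b) ⟩
      ∣ (ℚ.- a) ℚ.- (ℚ.- b) ∣  ∎) ab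
    where open ≡-Reasoning
          open +-*-Solver

  tolerance : (ε K : ℚ) → 0ℚ ℚ.< K → ℚ
  tolerance ε K 0<K = (½ ℚ.* ε) ℚ.* (ℚ.1/ K) {{ℚ.pos⇒nonZero K {{ℚ.positive 0<K}}}}

  0<tolerance : ∀ ε K (0<K : 0ℚ ℚ.< K) → 0ℚ ℚ.< ε → 0ℚ ℚ.< tolerance ε K 0<K
  0<tolerance ε K 0<K 0<ε =
    ℚ.positive⁻¹ _ {{ℚ.pos*pos⇒pos (½ ℚ.* ε) {{ℚ.positive (0<½ε 0<ε)}}
      ((ℚ.1/ K) {{ℚ.pos⇒nonZero K {{ℚ.positive 0<K}}}})
      {{ℚ.1/pos⇒pos K {{ℚ.positive 0<K}}}}}}

  ∣p*q∣<½ε : ∀ {ε} p q K (0<K : 0ℚ ℚ.< K) →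
             ∣ p ∣ ℚ.≤ K → ∣ q ∣ ℚ.< tolerance ε K 0<K → ∣ p ℚ.* q ∣ ℚ.< ½ ℚ.* ε
  ∣p*q∣<½ε {ε} p q K 0<K p≤K q<δ = begin-strict
    ∣ p ℚ.* q ∣                        ≡⟨ ℚ.∣p*q∣≡∣p∣*∣q∣ p q ⟩
    ∣ p ∣ ℚ.* ∣ q ∣                    ≤⟨ ℚ.*-monoʳ-≤-nonNeg ∣ q ∣ {{ℚ.∣-∣-nonNeg q}} p≤K ⟩
    K ℚ.* ∣ q ∣                        <⟨ ℚ.*-monoʳ-<-pos K q<δ ⟩
    K ℚ.* ((½ ℚ.* ε) ℚ.* ℚ.1/ K)       ≡⟨ cong (K ℚ.*_) (ℚ.*-comm (½ ℚ.* ε) (ℚ.1/ K)) ⟩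
    K ℚ.* (ℚ.1/ K ℚ.* (½ ℚ.* ε))       ≡⟨ ℚ.*-assoc K (ℚ.1/ K) (½ ℚ.* ε) ⟨
    (K ℚ.* ℚ.1/ K) ℚ.* (½ ℚ.* ε)       ≡⟨ cong (ℚ._* (½ ℚ.* ε)) (ℚ.*-inverseʳ K) ⟩
    1ℚ ℚ.* (½ ℚ.* ε)                   ≡⟨ ℚ.*-identityˡ (½ ℚ.* ε) ⟩
    ½ ℚ.* ε                            ∎
    where
    open ℚ.≤-Reasoning
    instance
      K-pos : ℚ.Positive K
      K-pos = ℚ.positive 0<K
      K-nonZero : ℚ.NonZero K
      K-nonZero = ℚ.pos⇒nonZero K

  *-close : ∀ {ε} a b c d K (0<K : 0ℚ ℚ.< K) → ∣ a ∣ ℚ.≤ K → ∣ d ∣ ℚ.≤ K →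
            ∣ a ℚ.- c ∣ ℚ.< tolerance ε K 0<K → ∣ b ℚ.- d ∣ ℚ.< tolerance ε K 0<K →
            ∣ (a ℚ.* b) ℚ.- (c ℚ.* d) ∣ ℚ.< ε
  *-close {ε} a b c d K 0<K a≤K d≤K ac bd =
    subst (λ t → ∣ t ∣ ℚ.< ε)
      (solve 4 (λ a b c d → a :* (b :- d) :+ d :* (a :- c) := a :* b :- c :* d) refl a b c d)
      (∣p+q∣<ε (a ℚ.* (b ℚ.- d)) (d ℚ.* (a ℚ.- c))
        (∣p*q∣<½ε {ε} a (b ℚ.- d) K 0<K a≤K bd)
        (∣p*q∣<½ε {ε} d (a ℚ.- c) K 0<K d≤K ac))
    where open +-*-Solver

  0<1 : 0ℚ ℚ.< 1ℚ
  0<1 = ℚ.positive⁻¹ 1ℚ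

  bound : (x : ℝ) → ∃[ K ] 0ℚ ℚ.< K × ∃[ N ] ∀ n → N ℕ.≤ n → ∣ seq x n ∣ ℚ.≤ K
  bound x = K , 0<K , N , λ n N≤n → ℚ.<⇒≤ (lemma n N≤n)
    where
    N = proj₁ (cauchy x 1ℚ 0<1)
    s = seq x
    K = 1ℚ ℚ.+ ∣ s N ∣

    0<K : 0ℚ ℚ.< K
    0<K = ℚ.+-mono-<-≤ 0<1 (ℚ.0≤∣p∣ (s N))

    lemma : ∀ n → N ℕ.≤ n → ∣ s n ∣ ℚ.< K
    lemma n N≤n = begin-strict
      ∣ s n ∣                      ≡⟨ cong ∣_∣ (solve 2 (λ a b → a := (a :- b) :+ b) refl (s n) (s N)) ⟩
      ∣ (s n ℚ.- s N) ℚ.+ s N ∣    ≤⟨ ℚ.∣p+q∣≤∣p∣+∣q∣ (s n ℚ.- s N) (s N) ⟩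
      ∣ s n ℚ.- s N ∣ ℚ.+ ∣ s N ∣  <⟨ ℚ.+-monoˡ-< ∣ s N ∣ (proj₂ (cauchy x 1ℚ 0<1) n N N≤n ℕ.≤-refl) ⟩
      1ℚ ℚ.+ ∣ s N ∣               ∎
      where open ℚ.≤-Reasoning
            open +-*-Solver

  bound₂ : (x y : ℝ) → ∃[ K ] 0ℚ ℚ.< K × ∃[ N ] ∀ n → N ℕ.≤ n →
           ∣ seq x n ∣ ℚ.≤ K × ∣ seq y n ∣ ℚ.≤ K
  bound₂ x y =
    let K , 0<K , M , x≤ = bound x
        L , 0<L , N , y≤ = bound y
    in K ℚ.⊔ L , ℚ.<-≤-trans 0<K (ℚ.p≤p⊔q K L) , M ℕ.⊔ N , λ n le →
         ℚ.≤-trans (x≤ n (ℕ.m⊔n≤o⇒m≤o M N le)) (ℚ.p≤p⊔q K L) ,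
         ℚ.≤-trans (y≤ n (ℕ.m⊔n≤o⇒n≤o M N le)) (ℚ.p≤q⊔p K L)

abstract
  const-cauchy : ∀ q → Cauchy (λ _ → q)
  const-cauchy q ε 0<ε = 0 , λ _ _ _ _ → ∣p-p∣<ε q 0<ε

  +-cauchy : ∀ x y → Cauchy (λ n → seq x n ℚ.+ seq y n)
  +-cauchy x y ε 0<ε =
    let M , x-close = cauchy x (½ ℚ.* ε) (0<½ε 0<ε)
        N , y-close = cauchy y (½ ℚ.* ε) (0<½ε 0<ε)
    in M ℕ.⊔ N , λ m n le le′ →
       +-close (seq x m) (seq y m) (seq x n) (seq y n)
         (x-close m n (ℕ.m⊔n≤o⇒m≤o M N le) (ℕ.m⊔n≤o⇒m≤o M N le′))
         (y-close m n (ℕ.m⊔n≤o⇒n≤o M N le) (ℕ.m⊔n≤o⇒n≤o M N le′))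

  neg-cauchy : ∀ x → Cauchy (λ n → ℚ.- seq x n)
  neg-cauchy x ε 0<ε =
    let N , x-close = cauchy x ε 0<ε
    in N , λ m n le le′ → neg-close (seq x m) (seq x n) (x-close m n le le′)

  *-cauchy : ∀ x y → Cauchy (λ n → seq x n ℚ.* seq y n)
  *-cauchy x y ε 0<ε =
    let K , 0<K , L , bounded = bound₂ x y
        0<δ = 0<tolerance ε K 0<K 0<ε
        M , x-close = cauchy x (tolerance ε K 0<K) 0<δ
        N , y-close = cauchy y (tolerance ε K 0<K) 0<δ
    in L ℕ.⊔ (M ℕ.⊔ N) , λ m n le le′ →
       let MN≤m = ℕ.m⊔n≤o⇒n≤o L (M ℕ.⊔ N) le
           MN≤n = ℕ.m⊔n≤o⇒n≤o L (M ℕ.⊔ N) le′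
       in *-close (seq x m) (seq y m) (seq x n) (seq y n) K 0<K
            (proj₁ (bounded m (ℕ.m⊔n≤o⇒m≤o L (M ℕ.⊔ N) le)))
            (proj₂ (bounded n (ℕ.m⊔n≤o⇒m≤o L (M ℕ.⊔ N) le′)))
            (x-close m n (ℕ.m⊔n≤o⇒m≤o M N MN≤m) (ℕ.m⊔n≤o⇒m≤o M N MN≤n))
            (y-close m n (ℕ.m⊔n≤o⇒n≤o M N MN≤m) (ℕ.m⊔n≤o⇒n≤o M N MN≤n))

fromℚ : ℚ → ℝ
fromℚ q = mkℝ (λ _ → q) (const-cauchy q)

0ℝ 1ℝ : ℝ
0ℝ = fromℚ 0ℚ
1ℝ = fromℚ 1ℚ

infixl 6 _+ℝ_
infixl 7 _*ℝ_
infix  8 -ℝ_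

_+ℝ_ _*ℝ_ : ℝ → ℝ → ℝ
x +ℝ y = mkℝ (λ n → seq x n ℚ.+ seq y n) (+-cauchy x y)
x *ℝ y = mkℝ (λ n → seq x n ℚ.* seq y n) (*-cauchy x y)

-ℝ_ : ℝ → ℝ
-ℝ x = mkℝ (λ n → ℚ.- seq x n) (neg-cauchy x)

≗⇒≈ : ∀ {x y} → (∀ n → seq x n ≡ seq y n) → x ≈ℝ y
≗⇒≈ {x} {y} eq = mk≈ λ ε 0<ε → 0 , λ n _ →
  subst (λ t → ∣ t ℚ.- seq y n ∣ ℚ.< ε) (sym (eq n)) (∣p-p∣<ε (seq y n) 0<ε)

≈-sym : ∀ {x y} → x ≈ℝ y → y ≈ℝ x
≈-sym {x} {y} x≈y = mk≈ λ ε 0<ε →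
  let N , c = close x≈y ε 0<ε
  in N , λ n le → subst (ℚ._< ε) (∣p-q∣-comm (seq x n) (seq y n)) (c n le)

≈-trans : ∀ {x y z} → x ≈ℝ y → y ≈ℝ z → x ≈ℝ z
≈-trans {x} {y} {z} x≈y y≈z = mk≈ λ ε 0<ε →
  let M , c = close x≈y (½ ℚ.* ε) (0<½ε 0<ε)
      N , d = close y≈z (½ ℚ.* ε) (0<½ε 0<ε)
  in M ℕ.⊔ N , λ n le → ∣p-r∣<ε (seq x n) (seq y n) (seq z n)
       (c n (ℕ.m⊔n≤o⇒m≤o M N le)) (d n (ℕ.m⊔n≤o⇒n≤o M N le))

+ℝ-cong : ∀ {x x′ y y′} → x ≈ℝ x′ → y ≈ℝ y′ → x +ℝ y ≈ℝ x′ +ℝ y′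
+ℝ-cong {x} {x′} {y} {y′} x≈ y≈ = mk≈ λ ε 0<ε →
  let M , c = close x≈ (½ ℚ.* ε) (0<½ε 0<ε)
      N , d = close y≈ (½ ℚ.* ε) (0<½ε 0<ε)
  in M ℕ.⊔ N , λ n le → +-close (seq x n) (seq y n) (seq x′ n) (seq y′ n)
       (c n (ℕ.m⊔n≤o⇒m≤o M N le)) (d n (ℕ.m⊔n≤o⇒n≤o M N le))

-ℝ-cong : ∀ {x y} → x ≈ℝ y → -ℝ x ≈ℝ -ℝ y
-ℝ-cong {x} {y} x≈y = mk≈ λ ε 0<ε →
  let N , c = close x≈y ε 0<ε
  in N , λ n le → neg-close (seq x n) (seq y n) (c n le)

*ℝ-cong : ∀ {x x′ y y′} → x ≈ℝ x′ → y ≈ℝ y′ → x *ℝ y ≈ℝ x′ *ℝ y′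
*ℝ-cong {x} {x′} {y} {y′} x≈ y≈ = mk≈ λ ε 0<ε →
  let K , 0<K , L , bounded = bound₂ x y′
      0<δ = 0<tolerance ε K 0<K 0<ε
      M , c = close x≈ (tolerance ε K 0<K) 0<δ
      N , d = close y≈ (tolerance ε K 0<K) 0<δ
  in L ℕ.⊔ (M ℕ.⊔ N) , λ n le →
     let L≤n  = ℕ.m⊔n≤o⇒m≤o L (M ℕ.⊔ N) le
         MN≤n = ℕ.m⊔n≤o⇒n≤o L (M ℕ.⊔ N) le
     in *-close (seq x n) (seq y n) (seq x′ n) (seq y′ n) K 0<K
          (proj₁ (bounded n L≤n)) (proj₂ (bounded n L≤n))
          (c n (ℕ.m⊔n≤o⇒m≤o M N MN≤n)) (d n (ℕ.m⊔n≤o⇒n≤o M N MN≤n))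

ℝ-commutativeRing : CommutativeRing 0ℓ 0ℓ
ℝ-commutativeRing = record
  { Carrier = ℝ ; _≈_ = _≈ℝ_ ; _+_ = _+ℝ_ ; _*_ = _*ℝ_ ; -_ = -ℝ_ ; 0# = 0ℝ ; 1# = 1ℝ
  ; isCommutativeRing = record
    { isRing = record
      { +-isAbelianGroup = record
        { isGroup = record
          { isMonoid = record
            { isSemigroup = record
              { isMagma = record
                { isEquivalence = record
                  { refl = ≗⇒≈ λ _ → refl ; sym = ≈-sym ; trans = ≈-trans }
                ; ∙-cong = +ℝ-cong
                }
              ; assoc = λ x y z → ≗⇒≈ λ n → ℚ.+-assoc (seq x n) (seq y n) (seq z n)
              }
            ; identity = (λ x → ≗⇒≈ λ n → ℚ.+-identityˡ (seq x n))
                       , (λ x → ≗⇒≈ λ n → ℚ.+-identityʳ (seq x n))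
            }
          ; inverse = (λ x → ≗⇒≈ λ n → ℚ.+-inverseˡ (seq x n))
                    , (λ x → ≗⇒≈ λ n → ℚ.+-inverseʳ (seq x n))
          ; ⁻¹-cong = -ℝ-cong
          }
        ; comm = λ x y → ≗⇒≈ λ n → ℚ.+-comm (seq x n) (seq y n)
        }
      ; *-cong = *ℝ-cong
      ; *-assoc = λ x y z → ≗⇒≈ λ n → ℚ.*-assoc (seq x n) (seq y n) (seq z n)
      ; *-identity = (λ x → ≗⇒≈ λ n → ℚ.*-identityˡ (seq x n))
                   , (λ x → ≗⇒≈ λ n → ℚ.*-identityʳ (seq x n))
      ; distrib = (λ x y z → ≗⇒≈ λ n → ℚ.*-distribˡ-+ (seq x n) (seq y n) (seq z n))
                , (λ x y z → ≗⇒≈ λ n → ℚ.*-distribʳ-+ (seq x n) (seq y n) (seq z n))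
      }
    ; *-comm = λ x y → ≗⇒≈ λ n → ℚ.*-comm (seq x n) (seq y n)
    }
  }

record Submodule {R : Ring r ℓr} (M : LeftModule R m ℓm) p : Set (r ⊔ m ⊔ ℓm ⊔ lsuc p) where
  open Ring R using (Carrier)
  open LeftModule M
  field
    Member   : Carrierᴹ → Set p
    resp-≈ᴹ  : ∀ {u v} → u ≈ᴹ v → Member u → Member v
    0ᴹ-mem   : Member 0ᴹ
    +ᴹ-mem   : ∀ {u v} → Member u → Member v → Member (u +ᴹ v)
    *ₗ-mem   : ∀ (c : Carrier) {u} → Member u → Member (c *ₗ u)

module _ {R : Ring r ℓr} {M : LeftModule R m ℓm} where
  open Ring R using (Carrier; _≈_; 0#)
  open LeftModule M

  module _ {I : Set i} (v : I → Carrierᴹ) where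

    linearCombination : (I → Carrier) → List I → Carrierᴹ
    linearCombination c = foldr (λ k u → c k *ₗ v k +ᴹ u) 0ᴹ

    -- Repetition-free lists play the role of finite subsets of I.
    LinearlyIndependent : Set (r ⊔ ℓr ⊔ ℓm ⊔ i)
    LinearlyIndependent = ∀ (ks : List I) → Unique ks → ∀ (c : I → Carrier) →
      linearCombination c ks ≈ᴹ 0ᴹ → ∀ {k} → k ∈ ks → c k ≈ 0#

  record IsBasis (W : Submodule M p) {I : Set i} (v : I → Carrierᴹ)
                 : Set (r ⊔ ℓr ⊔ m ⊔ ℓm ⊔ p ⊔ i) where
    open Submodule W
    field
      member              : ∀ k → Member (v k)
      linearlyIndependent : LinearlyIndependent v
      spanning            : ∀ {u} → Member u →
                            ∃[ ks ] ∃[ c ] linearCombination v c ks ≈ᴹ u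

  HasDimension : Submodule M p → ℕ → Set (r ⊔ ℓr ⊔ m ⊔ ℓm ⊔ p)
  HasDimension W n = ∃[ v ] IsBasis W {I = Fin n} v

Vertex : ℕ → Set
Vertex D = Vec (Fin 2) D

private
  variable
    D : ℕ

_≟ⱽ_ : (x y : Vertex D) → Dec (x ≡ y)
_≟ⱽ_ = Vec.≡-dec Fin._≟_

Adjacent : Vertex D → Vertex D → Set
Adjacent x y = ∃! _≡_ λ k → lookup x k ≢ lookup y k

adjacent? : (x y : Vertex D) → Dec (Adjacent x y)
adjacent? x y = map′
  (λ (k , d , u) → k , d , λ {l} → u l)
  (λ (k , d , u) → k , d , λ l → u {l})
  (Fin.any? λ k → differ? k ×-dec Fin.all? λ l → differ? l →-dec (k Fin.≟ l))
  where
  differ? : ∀ k → Dec (lookup x k ≢ lookup y k)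
  differ? k = ¬? (lookup x k Fin.≟ lookup y k)

module HypercubeMatrices {c ℓ} (K : CommutativeRing c ℓ) where

  private module R = CommutativeRing K

  Matrix : ℕ → Set c
  Matrix D = Vertex D → Vertex D → R.Carrier

  ∑ : (Vertex D → R.Carrier) → R.Carrier
  ∑ {zero}  f = f []
  ∑ {suc D} f = ∑ (λ x → f (0F ∷ x)) R.+ ∑ (λ x → f (1F ∷ x))

  infix  4 _≈ₘ_
  infixl 6 _+ₘ_ _-ₘ_
  infixr 7 _*ₛ_
  infixl 7 _·_
  infix  8 -ₘ_
  infix  9 _ᵗ

  _≈ₘ_ : Matrix D → Matrix D → Set ℓ
  B ≈ₘ C = ∀ x y → B x y R.≈ C x y

  0ₘ : Matrix D
  0ₘ x y = R.0#

  _+ₘ_ _-ₘ_ _·_ : Matrix D → Matrix D → Matrix D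
  (B +ₘ C) x y = B x y R.+ C x y
  (B -ₘ C) x y = B x y R.+ R.- C x y
  (B · C) x y = ∑ λ z → B x z R.* C z y

  -ₘ_ _ᵗ : Matrix D → Matrix D
  (-ₘ B) x y = R.- B x y
  (B ᵗ) x y = B y x

  _*ₛ_ : R.Carrier → Matrix D → Matrix D
  (c *ₛ B) x y = c R.* B x y

  matrixSpace : ∀ D → LeftModule R.ring c ℓ
  matrixSpace D = record
    { Carrierᴹ = Matrix D ; _≈ᴹ_ = _≈ₘ_ ; _+ᴹ_ = _+ₘ_ ; _*ₗ_ = _*ₛ_ ; 0ᴹ = 0ₘ ; -ᴹ_ = -ₘ_
    ; isLeftModule = record
      { isLeftSemimodule = record
        { +ᴹ-isCommutativeMonoid = record
          { isMonoid = record
            { isSemigroup = record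
              { isMagma = record
                { isEquivalence = record
                  { refl  = λ _ _ → R.refl
                  ; sym   = λ p x y → R.sym (p x y)
                  ; trans = λ p q x y → R.trans (p x y) (q x y)
                  }
                ; ∙-cong = λ p q x y → R.+-cong (p x y) (q x y)
                }
              ; assoc = λ A B C x y → R.+-assoc (A x y) (B x y) (C x y)
              }
            ; identity = (λ B x y → R.+-identityˡ (B x y))
                       , (λ B x y → R.+-identityʳ (B x y))
            }
          ; comm = λ B C x y → R.+-comm (B x y) (C x y)
          }
        ; isPreleftSemimodule = record
          { *ₗ-cong      = λ p q x y → R.*-cong p (q x y)
          ; *ₗ-zeroˡ     = λ B x y → R.zeroˡ (B x y)
          ; *ₗ-distribʳ  = λ B a b x y → R.distribʳ (B x y) a b
          ; *ₗ-identityˡ = λ B x y → R.*-identityˡ (B x y)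
          ; *ₗ-assoc     = λ a b B x y → R.*-assoc a b (B x y)
          ; *ₗ-zeroʳ     = λ c x y → R.zeroʳ c
          ; *ₗ-distribˡ  = λ c B C x y → R.distribˡ c (B x y) (C x y)
          }
        }
      ; -ᴹ‿cong    = λ p x y → R.-‿cong (p x y)
      ; -ᴹ‿inverse = (λ B x y → R.-‿inverseˡ (B x y))
                   , (λ B x y → R.-‿inverseʳ (B x y))
      }
    }

  A : Matrix D
  A x y = if does (adjacent? x y) then R.1# else R.0#

  sign : Fin 2 → R.Carrier
  sign 0F = R.1#
  sign 1F = R.- R.1#

  α* : Fin D → Matrix D
  α* k x y = if does (x ≟ⱽ y) then sign (lookup x k) else R.0#

  record IsALike (B : Matrix D) : Set ℓ where
    field
      commutes : B · A ≈ₘ A · B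
      support  : ∀ x y → x ≢ y → ¬ Adjacent x y → B x y R.≈ R.0#

  IsAntisymmetric : Matrix D → Set ℓ
  IsAntisymmetric B = B ᵗ ≈ₘ -ₘ B

  private
    open import Relation.Binary.Reasoning.Setoid R.setoid
    open CommutativeSemigroupProperties
      (CommutativeMonoid.commutativeSemigroup R.+-commutativeMonoid) using (interchange)
    open CommutativeSemigroupProperties
      (CommutativeMonoid.commutativeSemigroup R.*-commutativeMonoid) using (x∙yz≈y∙xz)
    open AbelianGroupProperties R.+-abelianGroup using (⁻¹-∙-comm; ε⁻¹≈ε)
    open RingProperties R.ring using (-‿distribʳ-*)

  ∑-cong : {f g : Vertex D → R.Carrier} → (∀ x → f x R.≈ g x) → ∑ f R.≈ ∑ g
  ∑-cong {zero}  p = p []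
  ∑-cong {suc D} p = R.+-cong (∑-cong λ x → p (0F ∷ x)) (∑-cong λ x → p (1F ∷ x))

  ∑-+ : (f g : Vertex D → R.Carrier) → ∑ (λ x → f x R.+ g x) R.≈ ∑ f R.+ ∑ g
  ∑-+ {zero}  f g = R.refl
  ∑-+ {suc D} f g = R.trans
    (R.+-cong (∑-+ (λ x → f (0F ∷ x)) (λ x → g (0F ∷ x)))
              (∑-+ (λ x → f (1F ∷ x)) (λ x → g (1F ∷ x))))
    (interchange _ _ _ _)

  ∑-* : (c : R.Carrier) (f : Vertex D → R.Carrier) → ∑ (λ x → c R.* f x) R.≈ c R.* ∑ f
  ∑-* {zero}  c f = R.refl
  ∑-* {suc D} c f = R.trans
    (R.+-cong (∑-* c (λ x → f (0F ∷ x))) (∑-* c (λ x → f (1F ∷ x))))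
    (R.sym (R.distribˡ c _ _))

  ·-cong : {B B′ C C′ : Matrix D} → B ≈ₘ B′ → C ≈ₘ C′ → B · C ≈ₘ B′ · C′
  ·-cong p q x y = ∑-cong λ z → R.*-cong (p x z) (q z y)

  ·-distribʳ : (B C E : Matrix D) → (B +ₘ C) · E ≈ₘ B · E +ₘ C · E
  ·-distribʳ B C E x y = R.trans (∑-cong λ z → R.distribʳ (E z y) (B x z) (C x z))
    (∑-+ (λ z → B x z R.* E z y) (λ z → C x z R.* E z y))

  ·-distribˡ : (E B C : Matrix D) → E · (B +ₘ C) ≈ₘ E · B +ₘ E · C
  ·-distribˡ E B C x y = R.trans (∑-cong λ z → R.distribˡ (E x z) (B z y) (C z y))
    (∑-+ (λ z → E x z R.* B z y) (λ z → E x z R.* C z y))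

  *ₛ-·ˡ : (c : R.Carrier) (B E : Matrix D) → (c *ₛ B) · E ≈ₘ c *ₛ (B · E)
  *ₛ-·ˡ c B E x y = R.trans (∑-cong λ z → R.*-assoc c (B x z) (E z y)) (∑-* c λ z → B x z R.* E z y)

  *ₛ-·ʳ : (c : R.Carrier) (E B : Matrix D) → E · (c *ₛ B) ≈ₘ c *ₛ (E · B)
  *ₛ-·ʳ c E B x y = R.trans (∑-cong λ z → x∙yz≈y∙xz (E x z) c (B z y)) (∑-* c λ z → E x z R.* B z y)

  antisymmetricALike : ∀ D → Submodule (matrixSpace D) ℓ
  antisymmetricALike D = record
    { Member  = λ B → IsAntisymmetric B × IsALike B
    ; resp-≈ᴹ = λ {B} {C} B≈C (anti , alike) →
        (λ x y → begin
          C y x       ≈⟨ B≈C y x ⟨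
          B y x       ≈⟨ anti x y ⟩
          R.- B x y    ≈⟨ R.-‿cong (B≈C x y) ⟩
          R.- C x y    ∎) ,
        record
          { commutes = λ x y → begin
              (C · A) x y  ≈⟨ ·-cong {B = B} {C} {A} {A} B≈C (λ _ _ → R.refl) x y ⟨
              (B · A) x y  ≈⟨ commutes alike x y ⟩
              (A · B) x y  ≈⟨ ·-cong {B = A} {A} {B} {C} (λ _ _ → R.refl) B≈C x y ⟩
              (A · C) x y  ∎
          ; support = λ x y x≢y ¬adj → R.trans (R.sym (B≈C x y)) (support alike x y x≢y ¬adj)
          }
    ; 0ᴹ-mem = (λ x y → R.sym ε⁻¹≈ε) , record
        { commutes = λ x y → ∑-cong λ z → R.trans (R.zeroˡ (A z y)) (R.sym (R.zeroʳ (A x z)))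
        ; support = λ _ _ _ _ → R.refl
        }
    ; +ᴹ-mem = λ {B} {C} (antiB , alikeB) (antiC , alikeC) →
        (λ x y → R.trans (R.+-cong (antiB x y) (antiC x y)) (⁻¹-∙-comm (B x y) (C x y))) ,
        record
          { commutes = λ x y → begin
              ((B +ₘ C) · A) x y          ≈⟨ ·-distribʳ B C A x y ⟩
              (B · A) x y R.+ (C · A) x y  ≈⟨ R.+-cong (commutes alikeB x y) (commutes alikeC x y) ⟩
              (A · B) x y R.+ (A · C) x y  ≈⟨ ·-distribˡ A B C x y ⟨
              (A · (B +ₘ C)) x y          ∎
          ; support = λ x y x≢y ¬adj → R.trans
              (R.+-cong (support alikeB x y x≢y ¬adj) (support alikeC x y x≢y ¬adj))
              (R.+-identityˡ R.0#)
          }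
    ; *ₗ-mem = λ c {B} (anti , alike) →
        (λ x y → R.trans (R.*-congˡ (anti x y)) (R.sym (-‿distribʳ-* c (B x y)))) ,
        record
          { commutes = λ x y → begin
              ((c *ₛ B) · A) x y  ≈⟨ *ₛ-·ˡ c B A x y ⟩
              c R.* (B · A) x y    ≈⟨ R.*-congˡ (commutes alike x y) ⟩
              c R.* (A · B) x y    ≈⟨ *ₛ-·ʳ c A B x y ⟨
              (A · (c *ₛ B)) x y  ∎
          ; support = λ x y x≢y ¬adj → R.trans (R.*-congˡ (support alike x y x≢y ¬adj)) (R.zeroʳ c)
          }
    }
    where open IsALike

open HypercubeMatrices ℝ-commutativeRing public

{-# OPTIONS --safe #-}
module Submission where

-- For an antisymmetric A-like B put bᵢ(x) = B(x, x + eᵢ) and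
-- Δⱼf(x) = f(x) − f(x + eⱼ). Antisymmetry gives bᵢ(x + eᵢ) = −bᵢ(x), and the
-- entries of BA = AB at (x, x + eᵢ + eⱼ) and (x, x) give Δⱼbᵢ = −Δᵢbⱼ and
-- Σᵢ bᵢ = 0. Then ΔₖΔⱼbᵢ is symmetric in j, k and antisymmetric in i, j, hence
-- zero, so B vanishes as soon as all Δⱼbᵢ with i < j vanish at the origin.
-- The forms B ↦ ¼ Δⱼbᵢ(0) are dual to the matrices αᵢ*Aαⱼ* − αⱼ*Aαᵢ*, so these
-- are a basis. The argument works over any commutative ring containing ½.

open import Algebra.Bundles using (Ring; CommutativeRing; CommutativeMonoid)
open import Algebra.Module.Bundles using (LeftModule)
open import Defs using (module HypercubeMatrices; Submodule; IsBasis; HasDimension; linearCombination; Vertex; _≟ⱽ_; Adjacent; adjacent?; ℝ-commutativeRing; fromℚ; ≗⇒≈)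
open import Data.Bool.Base using (if_then_else_)
open import Data.Fin.Base using (Fin; _<_; zero; suc; opposite)
open import Data.Fin.Patterns using (0F; 1F)
open import Data.Fin.Properties using (_≟_; +↔⊎; <⇒≢; <-trans; <-cmp; <-irrelevant; opposite-involutive; suc-injective)
open import Data.List.Base using (List; []; _∷_; map; allFin)
open import Data.List.Membership.Propositional using (_∈_)
open import Data.List.Membership.Propositional.Properties using (∈-map⁺; ∈-allFin)
import Data.List.Relation.Unary.All as All
open import Data.List.Relation.Unary.All using (All; []; _∷_)
open import Data.List.Relation.Unary.AllPairs using ([]; _∷_)
open import Data.List.Relation.Unary.Any using (here; there)
open import Data.List.Relation.Unary.Unique.Propositional using (Unique)
open import Data.List.Relation.Unary.Unique.Propositional.Properties using (map⁺; allFin⁺)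
open import Data.Nat.Base using (ℕ; _≤_; zero; suc; s≤s; z≤n; z<s; s<s)
import Data.Nat.Base as ℕ
open import Data.Nat.Combinatorics using (_C_; nC1≡n; nCk+nC[k+1]≡[n+1]C[k+1])
open import Data.Product.Base using (∃₂; _×_; _,_; proj₁; proj₂)
open import Data.Rational.Base using (½)
open import Data.Sum.Base using (_⊎_; inj₁; inj₂)
open import Data.Sum.Function.Propositional using (_⊎-↔_)
open import Data.Vec.Base using ([]; _∷_; lookup; updateAt; replicate)
open import Data.Vec.Properties using (lookup-replicate; ∷-injectiveʳ; lookup∘updateAt; lookup∘updateAt′; updateAt-updateAt; updateAt-id; updateAt-cong; updateAt-commutes; tabulate∘lookup; tabulate-cong)
open import Function.Base using (_∘_)
open import Function.Bundles using (_↔_; _⇔_; Injection; Inverse; mk↔ₛ′; mk⇔)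
open import Function.Construct.Composition using (_↔-∘_)
open import Function.Construct.Identity using (↔-id)
open import Function.Properties.Inverse using (↔⇒↣)
open import Level using (_⊔_)
open import Relation.Binary.Definitions using (tri<; tri≈; tri>)
open import Relation.Binary.PropositionalEquality as ≡ using (_≡_; _≢_; ≢-sym; cong; subst)
open import Relation.Nullary.Decidable using (yes; no; does; does-⇔; dec-true; dec-false; decidable-stable)
open import Relation.Nullary.Negation using (¬_; contradiction)

-- The symmetry argument needs distinct indices, so the vanishing of all Δⱼbᵢ with i ≠ j only shows
-- that bᵢ(x) is a constant cᵢ times the sign of xᵢ. The relation Σᵢ bᵢ = 0 is there to remove these
-- D remaining constants. The factor ¼ arises because, for the matrix with indices i < j, bᵢ is 2 at
-- the origin and -2 at eⱼ. Dual forms give independence and spanning together, with explicit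
-- coefficients and without deciding whether a real number is zero.

private
  variable
    D : ℕ

-- Dual bases

module _ {r ℓr m ℓm} {R : Ring r ℓr} (M : LeftModule R m ℓm) where
  open Ring R
  open LeftModule M

  record IsLinearForm (φ : Carrierᴹ → Carrier) : Set (r ⊔ ℓr ⊔ m ⊔ ℓm) where
    field
      ⟦⟧-cong : ∀ {u v} → u ≈ᴹ v → φ u ≈ φ v
      +ᴹ-homo : ∀ u v → φ (u +ᴹ v) ≈ φ u + φ v
      *ₗ-homo : ∀ c u → φ (c *ₗ u) ≈ c * φ u

    0ᴹ-homo : φ 0ᴹ ≈ 0#
    0ᴹ-homo = trans (⟦⟧-cong (≈ᴹ-sym (*ₗ-zeroˡ 0ᴹ))) (trans (*ₗ-homo 0# 0ᴹ) (zeroˡ _))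

module _ {r ℓr m ℓm p} {R : Ring r ℓr} {M : LeftModule R m ℓm} (W : Submodule M p) where
  open Ring R
  open LeftModule M
  open Submodule W

  module DualBasis
    {i} {I : Set i} (v : I → Carrierᴹ) (φ : I → Carrierᴹ → Carrier)
    (linear : ∀ k → IsLinearForm M (φ k))
    (dual-≡ : ∀ k → φ k (v k) ≈ 1#)
    (dual-≢ : ∀ {k l} → k ≢ l → φ k (v l) ≈ 0#)
    where

    open import Relation.Binary.Reasoning.Setoid setoid
    open module Linear k = IsLinearForm (linear k)

    private
      combination : (I → Carrier) → List I → Carrierᴹ
      combination = linearCombination {R = R} {M = M} v

    form-∷ : ∀ k c l ls → φ k (combination c (l ∷ ls)) ≈ c l * φ k (v l) + φ k (combination c ls)
    form-∷ k c l ls = trans (+ᴹ-homo k _ _) (+-congʳ (*ₗ-homo k _ _))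

    coordinate-∉ : ∀ k c {ls} → All (k ≢_) ls → φ k (combination c ls) ≈ 0#
    coordinate-∉ k c []                       = 0ᴹ-homo k
    coordinate-∉ k c {l ∷ ls} (k≢l ∷ k∉ls) = begin
      φ k (combination c (l ∷ ls))               ≈⟨ form-∷ k c l ls ⟩
      c l * φ k (v l) + φ k (combination c ls)   ≈⟨ +-cong (*-congˡ (dual-≢ k≢l)) (coordinate-∉ k c k∉ls) ⟩
      c l * 0# + 0#                              ≈⟨ +-identityʳ _ ⟩
      c l * 0#                                   ≈⟨ zeroʳ _ ⟩
      0#                                         ∎

    coordinate-∈ : ∀ {k} c {ls} → Unique ls → k ∈ ls → φ k (combination c ls) ≈ c k
    coordinate-∈ {k} c {.k ∷ ls} (k∉ls ∷ _) (here ≡.refl) = begin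
      φ k (combination c (k ∷ ls))               ≈⟨ form-∷ k c k ls ⟩
      c k * φ k (v k) + φ k (combination c ls)   ≈⟨ +-cong (*-congˡ (dual-≡ k)) (coordinate-∉ k c k∉ls) ⟩
      c k * 1# + 0#                              ≈⟨ +-identityʳ _ ⟩
      c k * 1#                                   ≈⟨ *-identityʳ _ ⟩
      c k                                        ∎
    coordinate-∈ {k} c {l ∷ ls} (l∉ls ∷ unique) (there k∈ls) = begin
      φ k (combination c (l ∷ ls))               ≈⟨ form-∷ k c l ls ⟩
      c l * φ k (v l) + φ k (combination c ls)   ≈⟨ +-cong (*-congˡ (dual-≢ (≢-sym (All.lookup l∉ls k∈ls)))) (coordinate-∈ c unique k∈ls) ⟩
      c l * 0# + c k                             ≈⟨ +-congʳ (zeroʳ _) ⟩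
      0# + c k                                   ≈⟨ +-identityˡ _ ⟩
      c k                                        ∎

    combination-mem : (∀ k → Member (v k)) → ∀ c ls → Member (combination c ls)
    combination-mem v-mem c []       = 0ᴹ-mem
    combination-mem v-mem c (l ∷ ls) = +ᴹ-mem (*ₗ-mem (c l) (v-mem l)) (combination-mem v-mem c ls)

    -- Applying the forms to a vanishing combination gives independence. For spanning, the
    -- combination with coefficients `φ k u` differs from `u` by a member that every form kills, and
    -- such a member is zero by the last hypothesis.
    isBasis : (ks : List I) → Unique ks → (∀ k → k ∈ ks) → (∀ k → Member (v k)) →
              (∀ {u} → Member u → (∀ k → φ k u ≈ 0#) → u ≈ᴹ 0ᴹ) → IsBasis W v
    isBasis ks unique complete v-mem separating = record
      { member              = v-mem
      ; linearlyIndependent = λ ls unique-ls c c≈0 {k} k∈ls →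
          trans (sym (coordinate-∈ c unique-ls k∈ls)) (trans (⟦⟧-cong k c≈0) (0ᴹ-homo k))
      ; spanning            = λ {u} u-mem → ks , (λ k → φ k u) ,
          let w = combination (λ k → φ k u) ks
              -- A submodule comes with closure under sums and scalars, so subtraction is addition
              -- of the multiple by `- 1#`.
              difference≈0 = separating (+ᴹ-mem (combination-mem v-mem _ ks) (*ₗ-mem (- 1#) u-mem)) λ k → begin
                φ k (w +ᴹ - 1# *ₗ u)        ≈⟨ trans (+ᴹ-homo k _ _) (+-congˡ (*ₗ-homo k _ _)) ⟩
                φ k w + - 1# * φ k u        ≈⟨ +-cong (coordinate-∈ _ unique (complete k)) (-1*x≈-x _) ⟩
                φ k u + - φ k u             ≈⟨ -‿inverseʳ _ ⟩
                0#                          ∎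
          in ≈ᴹ-trans (inverseˡ-unique _ _ difference≈0)
               (≈ᴹ-trans (-ᴹ‿cong (-1*u≈-u u)) (⁻¹-involutive u))
      }
      where
      open import Algebra.Properties.Ring R using (-1*x≈-x)
      open import Algebra.Properties.Group (LeftModule.+ᴹ-group M) using (inverseˡ-unique; inverseʳ-unique; ⁻¹-involutive)

      -1*u≈-u : ∀ u → (- 1#) *ₗ u ≈ᴹ -ᴹ u
      -1*u≈-u u = inverseʳ-unique _ _ (≈ᴹ-trans
        (+ᴹ-cong (≈ᴹ-sym (*ₗ-identityˡ u)) ≈ᴹ-refl)
        (≈ᴹ-trans (≈ᴹ-sym (*ₗ-distribʳ u 1# (- 1#)))
          (≈ᴹ-trans (*ₗ-cong (-‿inverseʳ 1#) ≈ᴹ-refl) (*ₗ-zeroˡ u))))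

-- Counting the pairs i < j

Pair : ℕ → Set
Pair D = ∃₂ λ (i j : Fin D) → i < j

-- The cases are whether or not the smaller entry is `zero`; if it is, the larger entry ranges
-- freely over the `D` successors.
Pair-suc↔ : (Fin D ⊎ Pair D) ↔ Pair (suc D)
Pair-suc↔ = mk↔ₛ′
  (λ { (inj₁ j) → zero , suc j , z<s ; (inj₂ (i , j , i<j)) → suc i , suc j , s<s i<j })
  (λ { (zero , suc j , _) → inj₁ j ; (suc i , suc j , s≤s i<j) → inj₂ (i , j , i<j) })
  (λ { (zero , suc j , s≤s z≤n) → ≡.refl ; (suc i , suc j , s≤s i<j) → ≡.refl })
  (λ { (inj₁ j) → ≡.refl ; (inj₂ _) → ≡.refl })

-- The split of the pairs mirrors Pascal's rule for `suc D C 2`, with `D C 1` equal to `D`.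
Fin↔Pair : ∀ D → Fin (D C 2) ↔ Pair D
Fin↔Pair zero    = mk↔ₛ′ (λ ()) (λ { (() , _) }) (λ { (() , _) }) (λ ())
Fin↔Pair (suc D) = subst (λ n → Fin n ↔ Pair (suc D)) pascal
  (Pair-suc↔ ↔-∘ ((↔-id (Fin D) ⊎-↔ Fin↔Pair D) ↔-∘ +↔⊎))
  where
  pascal : D ℕ.+ D C 2 ≡ suc D C 2
  pascal = ≡.trans (cong (ℕ._+ D C 2) (≡.sym (nC1≡n D))) (nCk+nC[k+1]≡[n+1]C[k+1] D 1)

-- Edges of the hypercube

-- This is x + eₖ in the notation of the overview.
flip : Fin D → Vertex D → Vertex D
flip k x = updateAt x k opposite

opposite-≢ : (a : Fin 2) → opposite a ≢ a
opposite-≢ 0F ()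
opposite-≢ 1F ()

≢⇒≡opposite : {a b : Fin 2} → a ≢ b → a ≡ opposite b
≢⇒≡opposite {0F} {0F} a≢b = contradiction ≡.refl a≢b
≢⇒≡opposite {0F} {1F} a≢b = ≡.refl
≢⇒≡opposite {1F} {0F} a≢b = ≡.refl
≢⇒≡opposite {1F} {1F} a≢b = contradiction ≡.refl a≢b

lookup-flip : ∀ k (x : Vertex D) → lookup (flip k x) k ≡ opposite (lookup x k)
lookup-flip k x = lookup∘updateAt k x

lookup-flip-≢ : ∀ {k l} → l ≢ k → (x : Vertex D) → lookup (flip k x) l ≡ lookup x l
lookup-flip-≢ l≢k x = lookup∘updateAt′ _ _ l≢k x

flip-involutive : ∀ k (x : Vertex D) → flip k (flip k x) ≡ x
flip-involutive k x = ≡.trans (updateAt-updateAt k x)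
  (≡.trans (updateAt-cong k opposite-involutive x) (updateAt-id k x))

flip-comm : ∀ k l (x : Vertex D) → flip k (flip l x) ≡ flip l (flip k x)
flip-comm k l x with k ≟ l
... | yes ≡.refl = ≡.refl
... | no k≢l     = updateAt-commutes k l k≢l x

lookup-injective : {x y : Vertex D} → (∀ k → lookup x k ≡ lookup y k) → x ≡ y
lookup-injective {x = x} {y} eq =
  ≡.trans (≡.sym (tabulate∘lookup x)) (≡.trans (tabulate-cong eq) (tabulate∘lookup y))

flip-adjacent : ∀ k (x : Vertex D) → Adjacent (flip k x) x
flip-adjacent k x = k ,
  (λ eq → opposite-≢ _ (≡.trans (≡.sym (lookup-flip k x)) eq)) ,
  λ {l} differ → decidable-stable (k ≟ l) λ k≢l → differ (lookup-flip-≢ (≢-sym k≢l) x)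

adjacent⇒flip : ∀ (x y : Vertex D) (adj : Adjacent x y) → x ≡ flip (proj₁ adj) y
adjacent⇒flip x y (k , differ , unique) = lookup-injective pointwise
  where
  pointwise : ∀ l → lookup x l ≡ lookup (flip k y) l
  pointwise l with l ≟ k
  ... | yes ≡.refl = ≡.trans (≢⇒≡opposite differ) (≡.sym (lookup-flip k y))
  ... | no l≢k     = ≡.trans
    (decidable-stable (lookup x l ≟ lookup y l) λ differ′ → l≢k (≡.sym (unique differ′)))
    (≡.sym (lookup-flip-≢ l≢k y))

-- Uniqueness in `Adjacent` makes any coordinate seen to differ the direction of the edge.
adjacent⇒flip-at : ∀ (x y : Vertex D) → Adjacent x y → ∀ l → lookup x l ≢ lookup y l → x ≡ flip l y
adjacent⇒flip-at x y adj@(_ , _ , unique) l differ =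
  ≡.trans (adjacent⇒flip x y adj) (cong (λ k → flip k y) (unique differ))

flip⇒adjacent : ∀ (x y : Vertex D) k → x ≡ flip k y → Adjacent x y
flip⇒adjacent .(flip k y) y k ≡.refl = flip-adjacent k y

Adjacent-sym : ∀ (x y : Vertex D) → Adjacent x y → Adjacent y x
Adjacent-sym x y (k , differ , unique) = k , ≢-sym differ , λ d → unique (≢-sym d)

Adjacent-flip : ∀ k (x y : Vertex D) → Adjacent x y → Adjacent (flip k x) (flip k y)
Adjacent-flip k x y adj@(l , _) = flip⇒adjacent (flip k x) (flip k y) l
  (≡.trans (cong (flip k) (adjacent⇒flip x y adj)) (flip-comm k l y))

Adjacent-flip⇔ : ∀ k (x y : Vertex D) → Adjacent x (flip k y) ⇔ Adjacent (flip k x) y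
Adjacent-flip⇔ k x y = mk⇔
  (λ adj → subst (Adjacent (flip k x)) (flip-involutive k y) (Adjacent-flip k x (flip k y) adj))
  (λ adj → subst (λ z → Adjacent z (flip k y)) (flip-involutive k x) (Adjacent-flip k (flip k x) y adj))

Adjacent-∷⇔ : ∀ a (x y : Vertex D) → Adjacent (a ∷ x) (a ∷ y) ⇔ Adjacent x y
Adjacent-∷⇔ a x y = mk⇔
  (λ { (zero , differ , _)       → contradiction ≡.refl differ
     ; (suc k , differ , unique) → k , differ , λ d → suc-injective (unique {suc _} d) })
  (λ adj@(k , _) → flip⇒adjacent (a ∷ x) (a ∷ y) (suc k) (cong (a ∷_) (adjacent⇒flip x y adj)))

Adjacent-opposite⇒≡ : ∀ a (x y : Vertex D) → Adjacent (opposite a ∷ x) (a ∷ y) → x ≡ y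
Adjacent-opposite⇒≡ a x y adj =
  ∷-injectiveʳ (adjacent⇒flip-at (opposite a ∷ x) (a ∷ y) adj zero (opposite-≢ a))

differ-twice⇒¬Adjacent : ∀ {i j} (x y : Vertex D) → i ≢ j →
  lookup x i ≢ lookup y i → lookup x j ≢ lookup y j → ¬ Adjacent x y
differ-twice⇒¬Adjacent x y i≢j differᵢ differⱼ (_ , _ , unique) =
  i≢j (≡.trans (≡.sym (unique differᵢ)) (unique differⱼ))

-- Here `x` differs from `flip i y` at `i`, so the edge has direction `i` and `x` is `y` itself, a
-- neighbour of every `flip j y`.
Adjacent-swap-≡ : ∀ {i j} (x y : Vertex D) → lookup x i ≡ lookup y i →
  Adjacent x (flip i y) → Adjacent x (flip j y)
Adjacent-swap-≡ {i = i} {j} x y eq adj = subst (λ z → Adjacent z (flip j y)) (≡.sym x≡y)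
  (Adjacent-sym (flip j y) y (flip-adjacent j y))
  where
  x≡y : x ≡ y
  x≡y = ≡.trans (adjacent⇒flip-at x (flip i y) adj i λ eq′ → opposite-≢ _
          (≡.trans (≡.sym (lookup-flip i y)) (≡.trans (≡.sym eq′) eq)))
          (flip-involutive i y)

-- Here `x` differs from `flip i y` at `j`, so `x` is `y` with both coordinates flipped, one flip
-- away from `flip j y`.
Adjacent-swap-≢ : ∀ {i j} (x y : Vertex D) → i ≢ j → lookup x j ≢ lookup y j →
  Adjacent x (flip i y) → Adjacent x (flip j y)
Adjacent-swap-≢ {i = i} {j} x y i≢j differ adj = flip⇒adjacent x (flip j y) i
  (≡.trans (adjacent⇒flip-at x (flip i y) adj j λ eq → differ (≡.trans eq (lookup-flip-≢ (≢-sym i≢j) y)))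
           (flip-comm j i y))

0ⱽ : Vertex D
0ⱽ = replicate _ 0F

-- The cube is connected: flipping the entries equal to `1F` leads from the origin to any vertex.
flip-induction : ∀ {p} (P : Vertex D → Set p) → P 0ⱽ → (∀ k x → P x → P (flip k x)) → ∀ x → P x
flip-induction P base step []       = base
flip-induction P base step (a ∷ x) = go a
  where
  P0 : P (0F ∷ x)
  P0 = flip-induction (P ∘ (0F ∷_)) base (λ k y → step (suc k) (0F ∷ y)) x
  go : ∀ a → P (a ∷ x)
  go 0F = P0
  go 1F = step zero (0F ∷ x) P0

module AntisymmetricALike
  {c ℓ} (K : CommutativeRing c ℓ) (½# : CommutativeRing.Carrier K)
  (½#+½#≈1# : CommutativeRing._≈_ K (CommutativeRing._+_ K ½# ½#) (CommutativeRing.1# K))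
  where

  open CommutativeRing K hiding (zero)
  open HypercubeMatrices K
  open import Algebra.Properties.AbelianGroup +-abelianGroup using (⁻¹-anti-homo‿-; ⁻¹-∙-comm; ⁻¹-involutive; ε⁻¹≈ε; x∙y⁻¹≈ε⇒x≈y; ∙-cancelʳ)
  open import Algebra.Properties.Ring ring using (-‿distribˡ-*; -‿distribʳ-*; x[y-z]≈xy-xz)
  open import Algebra.Properties.CommutativeMonoid.Sum +-commutativeMonoid using (sum; sum-cong-≋)
  import Algebra.Properties.CommutativeSemigroup (CommutativeMonoid.commutativeSemigroup +-commutativeMonoid) as +
  import Algebra.Properties.CommutativeSemigroup (CommutativeMonoid.commutativeSemigroup *-commutativeMonoid) as *
  open import Relation.Binary.Reasoning.Setoid setoid

  -- Arithmetic in a commutative ring containing ½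

  interchange- : ∀ a b c d → (a - b) - (c - d) ≈ (a - c) - (b - d)
  interchange- a b c d = begin
    (a - b) - (c - d)        ≈⟨ +-congˡ (⁻¹-∙-comm c (- d)) ⟨
    (a - b) + (- c - - d)    ≈⟨ +.interchange a (- b) (- c) (- - d) ⟩
    (a - c) + (- b - - d)    ≈⟨ +-congˡ (⁻¹-∙-comm b (- d)) ⟩
    (a - c) - (b - d)        ∎

  transpose- : ∀ {a b c d} → a + b ≈ c + d → a - d ≈ - (b - c)
  transpose- {a} {b} {c} {d} eq = x∙y⁻¹≈ε⇒x≈y _ _ (begin
    (a - d) - - (b - c)    ≈⟨ +-congˡ (⁻¹-involutive _) ⟩
    (a - d) + (b - c)      ≈⟨ +.interchange a (- d) b (- c) ⟩
    (a + b) + (- d - c)    ≈⟨ +-cong eq (trans (⁻¹-∙-comm d c) (-‿cong (+-comm d c))) ⟩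
    (c + d) - (c + d)      ≈⟨ -‿inverseʳ _ ⟩
    0#                     ∎)

  ½#*[x+x]≈x : ∀ x → ½# * (x + x) ≈ x
  ½#*[x+x]≈x x = begin
    ½# * (x + x)         ≈⟨ distribˡ ½# x x ⟩
    ½# * x + ½# * x      ≈⟨ distribʳ x ½# ½# ⟨
    (½# + ½#) * x        ≈⟨ *-congʳ ½#+½#≈1# ⟩
    1# * x               ≈⟨ *-identityˡ x ⟩
    x                    ∎

  ½#*x≈0⇒x≈0 : ∀ {x} → ½# * x ≈ 0# → x ≈ 0#
  ½#*x≈0⇒x≈0 {x} eq = begin
    x                    ≈⟨ ½#*[x+x]≈x x ⟨
    ½# * (x + x)         ≈⟨ distribˡ ½# x x ⟩
    ½# * x + ½# * x      ≈⟨ +-cong eq eq ⟩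
    0# + 0#              ≈⟨ +-identityˡ 0# ⟩
    0#                   ∎

  -- This turns sign relations into vanishing: of the diagonal of B, of Σₖ bₖ, of ΔₖΔⱼbᵢ and finally
  -- of bᵢ.
  x≈-x⇒x≈0 : ∀ {x} → x ≈ - x → x ≈ 0#
  x≈-x⇒x≈0 {x} eq = begin
    x               ≈⟨ ½#*[x+x]≈x x ⟨
    ½# * (x + x)    ≈⟨ *-congˡ (trans (+-congˡ eq) (-‿inverseʳ x)) ⟩
    ½# * 0#         ≈⟨ zeroʳ ½# ⟩
    0#              ∎

  x≈0⇒-x≈0 : ∀ {x} → x ≈ 0# → - x ≈ 0#
  x≈0⇒-x≈0 eq = trans (-‿cong eq) ε⁻¹≈ε

  -- Finite sums with one or two distinguished terms

  -- Replacing a term by zero, instead of deleting its index, keeps the index type, so a second term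
  -- can be treated in the same way.
  zeroAt : ∀ {n} → Fin n → (Fin n → Carrier) → Fin n → Carrier
  zeroAt i f k = if does (k ≟ i) then 0# else f k

  sum-zeroAt : ∀ {n} (i : Fin n) f → sum f ≈ f i + sum (zeroAt i f)
  sum-zeroAt zero    f = +-congˡ (sym (+-identityˡ _))
  sum-zeroAt (suc i) f = trans (+-congˡ (sum-zeroAt i (f ∘ suc))) (+.x∙yz≈y∙xz _ _ _)

  zeroAt-cong : ∀ {n} i (f g : Fin n → Carrier) k → (k ≢ i → f k ≈ g k) → zeroAt i f k ≈ zeroAt i g k
  zeroAt-cong i f g k eq with k ≟ i
  ... | yes _   = refl
  ... | no k≢i = eq k≢i

  sum-cancel₁ : ∀ {n} i (f g : Fin n → Carrier) → (∀ k → k ≢ i → f k ≈ g k) →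
                sum f ≈ sum g → f i ≈ g i
  sum-cancel₁ i f g f≈g eq = ∙-cancelʳ (sum (zeroAt i f)) _ _ (begin
    f i + sum (zeroAt i f)    ≈⟨ sum-zeroAt i f ⟨
    sum f                     ≈⟨ eq ⟩
    sum g                     ≈⟨ sum-zeroAt i g ⟩
    g i + sum (zeroAt i g)    ≈⟨ +-congˡ (sum-cong-≋ λ k → zeroAt-cong i f g k (f≈g k)) ⟨
    g i + sum (zeroAt i f)    ∎)

  module _ {n} {i j : Fin n} (i≢j : i ≢ j) where

    zeroAt₂ : (Fin n → Carrier) → Fin n → Carrier
    zeroAt₂ f = zeroAt j (zeroAt i f)

    sum-zeroAt₂ : ∀ f → sum f ≈ (f i + f j) + sum (zeroAt₂ f)
    sum-zeroAt₂ f = begin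
      sum f                                         ≈⟨ sum-zeroAt i f ⟩
      f i + sum (zeroAt i f)                        ≈⟨ +-congˡ (sum-zeroAt j (zeroAt i f)) ⟩
      f i + (zeroAt i f j + sum (zeroAt₂ f))        ≡⟨ cong (λ b → f i + ((if b then 0# else f j) + sum (zeroAt₂ f))) (dec-false (j ≟ i) (≢-sym i≢j)) ⟩
      f i + (f j + sum (zeroAt₂ f))                 ≈⟨ +-assoc _ _ _ ⟨
      (f i + f j) + sum (zeroAt₂ f)                 ∎

    module _ (f g : Fin n → Carrier) (f≈g : ∀ k → k ≢ i → k ≢ j → f k ≈ g k) where

      sum-zeroAt₂-cong : sum (zeroAt₂ f) ≈ sum (zeroAt₂ g)
      sum-zeroAt₂-cong = sum-cong-≋ λ k → zeroAt-cong j (zeroAt i f) (zeroAt i g) k λ k≢j → zeroAt-cong i f g k λ k≢i → f≈g k k≢i k≢j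

      -- Entries of BA and AB are sums over directions in which only two are exceptional. This lemma
      -- proves that the generators commute with `A`; its converse `sum-cancel₂` extracts a relation
      -- from a given BA = AB.
      sum-cong₂ : f i + f j ≈ g i + g j → sum f ≈ sum g
      sum-cong₂ eq = trans (sum-zeroAt₂ f) (trans (+-cong eq sum-zeroAt₂-cong) (sym (sum-zeroAt₂ g)))

      sum-cancel₂ : sum f ≈ sum g → f i + f j ≈ g i + g j
      sum-cancel₂ eq = ∙-cancelʳ (sum (zeroAt₂ f)) _ _ (begin
        (f i + f j) + sum (zeroAt₂ f)    ≈⟨ sum-zeroAt₂ f ⟨
        sum f                            ≈⟨ eq ⟩
        sum g                            ≈⟨ sum-zeroAt₂ g ⟩
        (g i + g j) + sum (zeroAt₂ g)    ≈⟨ +-congˡ sum-zeroAt₂-cong ⟨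
        (g i + g j) + sum (zeroAt₂ f)    ∎)

  sum-neg : ∀ {n} (f : Fin n → Carrier) → sum (λ k → - f k) ≈ - sum f
  sum-neg {zero}  f = sym ε⁻¹≈ε
  sum-neg {suc n} f = trans (+-congˡ (sum-neg (f ∘ suc))) (⁻¹-∙-comm _ _)

  -- Sums over vertices and products with A and αᵢ*

  ∑-zero : (f : Vertex D → Carrier) → (∀ z → f z ≈ 0#) → ∑ f ≈ 0#
  ∑-zero {zero}  f eq = eq []
  ∑-zero {suc D} f eq = trans (+-cong (∑-zero (f ∘ (0F ∷_)) (eq ∘ (0F ∷_))) (∑-zero (f ∘ (1F ∷_)) (eq ∘ (1F ∷_)))) (+-identityˡ 0#)

  ∑-single : (f : Vertex D → Carrier) → ∀ x → (∀ z → z ≢ x → f z ≈ 0#) → ∑ f ≈ f x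
  ∑-single f []        eq = refl
  ∑-single f (0F ∷ x) eq = trans
    (+-cong (∑-single (f ∘ (0F ∷_)) x λ z z≢x → eq (0F ∷ z) (z≢x ∘ ∷-injectiveʳ)) (∑-zero (f ∘ (1F ∷_)) λ z → eq (1F ∷ z) λ ()))
    (+-identityʳ _)
  ∑-single f (1F ∷ x) eq = trans
    (+-cong (∑-zero (f ∘ (0F ∷_)) λ z → eq (0F ∷ z) λ ()) (∑-single (f ∘ (1F ∷_)) x λ z z≢x → eq (1F ∷ z) (z≢x ∘ ∷-injectiveʳ)))
    (+-identityˡ _)

  A-adjacent : ∀ (x y : Vertex D) → Adjacent x y → A x y ≡ 1#
  A-adjacent x y adj = cong (if_then 1# else 0#) (dec-true (adjacent? x y) adj)

  A-nonadjacent : ∀ (x y : Vertex D) → ¬ Adjacent x y → A x y ≡ 0#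
  A-nonadjacent x y ¬adj = cong (if_then 1# else 0#) (dec-false (adjacent? x y) ¬adj)

  A-⇔ : ∀ {E} (x y : Vertex D) (x′ y′ : Vertex E) → Adjacent x y ⇔ Adjacent x′ y′ → A x y ≡ A x′ y′
  A-⇔ x y x′ y′ iff = cong (if_then 1# else 0#) (does-⇔ iff (adjacent? x y) (adjacent? x′ y′))

  A-sym : (x y : Vertex D) → A x y ≡ A y x
  A-sym x y = A-⇔ x y y x (mk⇔ (Adjacent-sym x y) (Adjacent-sym y x))

  ∑-opposite : ∀ a (f : Vertex D → Carrier) y → ∑ (λ z → f z * A (opposite a ∷ z) (a ∷ y)) ≈ f y
  ∑-opposite a f y = begin
    ∑ (λ z → f z * A (opposite a ∷ z) (a ∷ y))    ≈⟨ ∑-single _ y (λ z z≢y → trans (*-congˡ (reflexive (A-nonadjacent (opposite a ∷ z) (a ∷ y) (z≢y ∘ Adjacent-opposite⇒≡ a z y)))) (zeroʳ _)) ⟩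
    f y * A (opposite a ∷ y) (a ∷ y)              ≈⟨ *-congˡ (reflexive (A-adjacent (opposite a ∷ y) (a ∷ y) (flip-adjacent zero (a ∷ y)))) ⟩
    f y * 1#                                      ≈⟨ *-identityʳ _ ⟩
    f y                                           ∎

  -- Like `∑`, the induction splits the cube into two facets by the first coordinate: neighbours in
  -- the facet of `b ∷ y` come from the induction hypothesis, and the opposite facet contains
  -- exactly one.
  ∑-A : (f : Vertex D → Carrier) → ∀ y → ∑ (λ z → f z * A z y) ≈ sum (λ k → f (flip k y))
  ∑-A f []       = zeroʳ _
  ∑-A f (b ∷ y) = go b
    where
    same : ∀ b → ∑ (λ z → f (b ∷ z) * A (b ∷ z) (b ∷ y)) ≈ sum (λ k → f (b ∷ flip k y))
    same b = trans (∑-cong λ z → *-congˡ (reflexive (A-⇔ (b ∷ z) (b ∷ y) z y (Adjacent-∷⇔ b z y)))) (∑-A (f ∘ (b ∷_)) y)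

    go : ∀ b → ∑ (λ z → f z * A z (b ∷ y)) ≈ sum (λ k → f (flip k (b ∷ y)))
    -- `sum` starts with direction `zero`, which leads to the opposite facet, whereas `∑` starts
    -- with the facet of `0F`.
    go 0F = trans (+-cong (same 0F) (∑-opposite 0F (f ∘ (1F ∷_)) y)) (+-comm _ _)
    go 1F = +-cong (∑-opposite 1F (f ∘ (0F ∷_)) y) (same 1F)

  ·A : (B : Matrix D) → ∀ x y → (B · A) x y ≈ sum (λ k → B x (flip k y))
  ·A B x y = ∑-A (B x) y

  A· : (B : Matrix D) → ∀ x y → (A · B) x y ≈ sum (λ k → B (flip k x) y)
  A· B x y = trans
    (∑-cong λ z → trans (*-comm _ _) (*-congˡ (reflexive (A-sym x z))))
    (∑-A (λ z → B z y) x)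

  α*-≡ : ∀ i (x : Vertex D) → α* i x x ≡ sign (lookup x i)
  α*-≡ i x = cong (if_then sign (lookup x i) else 0#) (dec-true (x ≟ⱽ x) ≡.refl)

  α*-≢ : ∀ i {x y : Vertex D} → x ≢ y → α* i x y ≡ 0#
  α*-≢ i {x} {y} x≢y = cong (if_then sign (lookup x i) else 0#) (dec-false (x ≟ⱽ y) x≢y)

  α*· : ∀ i (B : Matrix D) x y → (α* i · B) x y ≈ sign (lookup x i) * B x y
  α*· i B x y = trans
    (∑-single _ x λ z z≢x → trans (*-congʳ (reflexive (α*-≢ i (≢-sym z≢x)))) (zeroˡ _))
    (*-congʳ (reflexive (α*-≡ i x)))

  ·α* : ∀ i (B : Matrix D) x y → (B · α* i) x y ≈ B x y * sign (lookup y i)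
  ·α* i B x y = trans
    (∑-single _ y λ z z≢y → trans (*-congˡ (reflexive (α*-≢ i z≢y))) (zeroʳ _))
    (*-congˡ (reflexive (α*-≡ i y)))

  -- The generators

  generator : Fin D → Fin D → Matrix D
  generator i j = α* i · A · α* j -ₘ α* j · A · α* i

  s : Fin D → Vertex D → Carrier
  s i x = sign (lookup x i)

  s-flip : ∀ i (x : Vertex D) → s i (flip i x) ≈ - s i x
  s-flip i x = trans (reflexive (cong sign (lookup-flip i x))) (sign-opposite (lookup x i))
    where
    sign-opposite : ∀ a → sign (opposite a) ≈ - sign a
    sign-opposite 0F = refl
    sign-opposite 1F = sym (⁻¹-involutive 1#)

  s-flip-≢ : ∀ {k l} → l ≢ k → (x : Vertex D) → s l (flip k x) ≈ s l x
  s-flip-≢ l≢k x = reflexive (cong sign (lookup-flip-≢ l≢k x))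

  s-≢ : ∀ {i} (x y : Vertex D) → lookup x i ≢ lookup y i → s i x ≈ - s i y
  s-≢ {i = i} x y differ = trans
    (reflexive (cong sign (≡.trans (≢⇒≡opposite differ) (≡.sym (lookup-flip i y)))))
    (s-flip i y)

  -- The determinant and the permanent of the 2 × 2 matrix with rows (sᵢ(x), sⱼ(x)) and (sᵢ(y),
  -- sⱼ(y)). The determinant gives the entries of the generators on edges; negating sᵢ(y) turns it
  -- into the permanent.
  wedge perm : Fin D → Fin D → Vertex D → Vertex D → Carrier
  wedge i j x y = s i x * s j y - s j x * s i y
  perm i j x y = s i x * s j y + s j x * s i y

  wedge-cong : ∀ {i j} (x y x′ y′ : Vertex D) → s i x ≈ s i x′ → s j x ≈ s j x′ → s i y ≈ s i y′ → s j y ≈ s j y′ →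
               wedge i j x y ≈ wedge i j x′ y′
  wedge-cong _ _ _ _ ix jx iy jy = +-cong (*-cong ix jy) (-‿cong (*-cong jx iy))

  wedge-anti : ∀ i j (x y : Vertex D) → wedge i j y x ≈ - wedge i j x y
  wedge-anti i j x y = trans
    (+-cong (*-comm _ _) (-‿cong (*-comm _ _)))
    (sym (⁻¹-anti-homo‿- _ _))

  wedge-swap : ∀ i j (x y : Vertex D) → wedge j i x y ≈ - wedge i j x y
  wedge-swap i j x y = sym (⁻¹-anti-homo‿- _ _)

  wedge-diagonal : ∀ i j (x : Vertex D) → wedge i j x x ≈ 0#
  wedge-diagonal i j x = trans (+-congʳ (*-comm _ _)) (-‿inverseʳ _)

  perm-swap : ∀ i j (x y : Vertex D) → perm j i x y ≈ perm i j x y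
  perm-swap i j x y = +-comm _ _

  wedge-flipʳ : ∀ {i j} → i ≢ j → (x y : Vertex D) → wedge i j x (flip i y) ≈ perm i j x y
  wedge-flipʳ {i = i} {j} i≢j x y = +-cong
    (*-congˡ (s-flip-≢ (≢-sym i≢j) y))
    (begin
      - (s j x * s i (flip i y))    ≈⟨ -‿cong (*-congˡ (s-flip i y)) ⟩
      - (s j x * - s i y)           ≈⟨ -‿cong (-‿distribʳ-* _ _) ⟨
      - - (s j x * s i y)           ≈⟨ ⁻¹-involutive _ ⟩
      s j x * s i y                 ∎)

  generator-entry : ∀ i j (x y : Vertex D) → generator i j x y ≈ A x y * wedge i j x y
  generator-entry i j x y = trans
    (+-cong (half i j) (-‿cong (half j i)))
    (sym (x[y-z]≈xy-xz _ _ _))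
    where
    half : ∀ i j → (α* i · A · α* j) x y ≈ A x y * (s i x * s j y)
    half i j = begin
      (α* i · A · α* j) x y        ≈⟨ ·α* j (α* i · A) x y ⟩
      (α* i · A) x y * s j y       ≈⟨ *-congʳ (α*· i A x y) ⟩
      s i x * A x y * s j y        ≈⟨ *.xy∙z≈y∙xz _ _ _ ⟩
      A x y * (s i x * s j y)      ∎

  generator-antisymmetric : ∀ i j → IsAntisymmetric (generator {D} i j)
  generator-antisymmetric i j x y = begin
    generator i j y x            ≈⟨ generator-entry i j y x ⟩
    A y x * wedge i j y x        ≈⟨ *-cong (reflexive (A-sym y x)) (wedge-anti i j x y) ⟩
    A x y * - wedge i j x y      ≈⟨ -‿distribʳ-* _ _ ⟨
    - (A x y * wedge i j x y)    ≈⟨ -‿cong (generator-entry i j x y) ⟨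
    - generator i j x y          ∎

  -- If x and y agree in exactly one of the coordinates i, j then perm vanishes;
  -- otherwise x is adjacent to y + eᵢ iff it is adjacent to y + eⱼ.
  A-perm : ∀ {i j} → i ≢ j → (x y : Vertex D) →
           A x (flip i y) * perm i j x y ≈ A x (flip j y) * perm i j x y
  A-perm {i = i} {j} i≢j x y with lookup x i ≟ lookup y i | lookup x j ≟ lookup y j
  ... | yes xᵢ≡yᵢ | yes xⱼ≡yⱼ = *-congʳ (reflexive (A-⇔ x (flip i y) x (flip j y) (mk⇔
    (Adjacent-swap-≡ {i = i} {j} x y xᵢ≡yᵢ) (Adjacent-swap-≡ {i = j} {i} x y xⱼ≡yⱼ))))
  ... | no xᵢ≢yᵢ  | no xⱼ≢yⱼ  = *-congʳ (reflexive (A-⇔ x (flip i y) x (flip j y) (mk⇔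
    (Adjacent-swap-≢ x y i≢j xⱼ≢yⱼ) (Adjacent-swap-≢ x y (≢-sym i≢j) xᵢ≢yᵢ))))
  ... | yes xᵢ≡yᵢ | no xⱼ≢yⱼ  = trans (trans (*-congˡ perm≈0) (zeroʳ _)) (sym (trans (*-congˡ perm≈0) (zeroʳ _)))
    where
    perm≈0 : perm i j x y ≈ 0#
    perm≈0 = begin
      s i x * s j y + s j x * s i y        ≈⟨ +-cong (*-congʳ (reflexive (cong sign xᵢ≡yᵢ))) (*-congʳ (s-≢ x y xⱼ≢yⱼ)) ⟩
      s i y * s j y + - s j y * s i y      ≈⟨ +-cong (*-comm _ _) (sym (-‿distribˡ-* _ _)) ⟩
      s j y * s i y - s j y * s i y        ≈⟨ -‿inverseʳ _ ⟩
      0#                                   ∎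
  ... | no xᵢ≢yᵢ  | yes xⱼ≡yⱼ = trans (trans (*-congˡ perm≈0) (zeroʳ _)) (sym (trans (*-congˡ perm≈0) (zeroʳ _)))
    where
    perm≈0 : perm i j x y ≈ 0#
    perm≈0 = begin
      s i x * s j y + s j x * s i y        ≈⟨ +-cong (*-congʳ (s-≢ x y xᵢ≢yᵢ)) (*-congʳ (reflexive (cong sign xⱼ≡yⱼ))) ⟩
      - s i y * s j y + s j y * s i y      ≈⟨ +-cong (sym (-‿distribˡ-* _ _)) (*-comm _ _) ⟩
      - (s i y * s j y) + s i y * s j y    ≈⟨ -‿inverseˡ _ ⟩
      0#                                   ∎

  -- The two flips turn the determinant into plus and minus the same permanent, and `A-perm` equates
  -- the adjacency factors in front.
  generator-flipʳ : ∀ {i j} → i ≢ j → (x y : Vertex D) →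
                    generator i j x (flip i y) + generator i j x (flip j y) ≈ 0#
  generator-flipʳ {i = i} {j} i≢j x y = begin
    generator i j x (flip i y) + generator i j x (flip j y)
      ≈⟨ +-cong (generator-entry i j x (flip i y)) (generator-entry i j x (flip j y)) ⟩
    A x (flip i y) * wedge i j x (flip i y) + A x (flip j y) * wedge i j x (flip j y)
      ≈⟨ +-cong (*-congˡ (wedge-flipʳ i≢j x y)) (*-congˡ (begin
           wedge i j x (flip j y)      ≈⟨ wedge-swap j i x (flip j y) ⟩
           - wedge j i x (flip j y)    ≈⟨ -‿cong (wedge-flipʳ (≢-sym i≢j) x y) ⟩
           - perm j i x y              ≈⟨ -‿cong (perm-swap i j x y) ⟩
           - perm i j x y              ∎)) ⟩
    A x (flip i y) * perm i j x y + A x (flip j y) * - perm i j x y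
      ≈⟨ +-cong (A-perm i≢j x y) (sym (-‿distribʳ-* _ _)) ⟩
    A x (flip j y) * perm i j x y - A x (flip j y) * perm i j x y
      ≈⟨ -‿inverseʳ _ ⟩
    0# ∎

  generator-flipˡ : ∀ {i j} → i ≢ j → (x y : Vertex D) →
                    generator i j (flip i x) y + generator i j (flip j x) y ≈ 0#
  generator-flipˡ {i = i} {j} i≢j x y = begin
    generator i j (flip i x) y + generator i j (flip j x) y
      ≈⟨ +-cong (generator-antisymmetric i j y (flip i x)) (generator-antisymmetric i j y (flip j x)) ⟩
    - generator i j y (flip i x) - generator i j y (flip j x)
      ≈⟨ ⁻¹-∙-comm _ _ ⟩
    - (generator i j y (flip i x) + generator i j y (flip j x))
      ≈⟨ x≈0⇒-x≈0 (generator-flipʳ i≢j y x) ⟩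
    0# ∎

  -- Adjacency is invariant under flipping both vertices, and `wedge` does not see coordinate `k`.
  generator-flip-≢ : ∀ {i j k} → k ≢ i → k ≢ j → (x y : Vertex D) →
                     generator i j x (flip k y) ≈ generator i j (flip k x) y
  generator-flip-≢ {i = i} {j} {k} k≢i k≢j x y = begin
    generator i j x (flip k y)                      ≈⟨ generator-entry i j x (flip k y) ⟩
    A x (flip k y) * wedge i j x (flip k y)         ≈⟨ *-cong (reflexive (A-⇔ x (flip k y) (flip k x) y (Adjacent-flip⇔ k x y)))
      (wedge-cong x (flip k y) (flip k x) y
        (sym (s-flip-≢ (≢-sym k≢i) x)) (sym (s-flip-≢ (≢-sym k≢j) x))
        (s-flip-≢ (≢-sym k≢i) y) (s-flip-≢ (≢-sym k≢j) y)) ⟩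
    A (flip k x) y * wedge i j (flip k x) y         ≈⟨ generator-entry i j (flip k x) y ⟨
    generator i j (flip k x) y                      ∎

  generator-member : ∀ {i j : Fin D} → i ≢ j → Submodule.Member (antisymmetricALike D) (generator i j)
  generator-member {i = i} {j} i≢j = generator-antisymmetric i j , record
    { commutes = λ x y → begin
        (generator i j · A) x y                      ≈⟨ ·A (generator i j) x y ⟩
        sum (λ k → generator i j x (flip k y))       ≈⟨ sum-cong₂ i≢j (λ k → generator i j x (flip k y)) (λ k → generator i j (flip k x) y)
          (λ k k≢i k≢j → generator-flip-≢ k≢i k≢j x y)
          -- The terms in directions `i` and `j` are compared only through their sum, which is zero
          -- on both sides.
          (trans (generator-flipʳ i≢j x y) (sym (generator-flipˡ i≢j x y))) ⟩
        sum (λ k → generator i j (flip k x) y)       ≈⟨ A· (generator i j) x y ⟨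
        (A · generator i j) x y                      ∎
    ; support = λ x y _ ¬adj → trans (generator-entry i j x y)
        (trans (*-congʳ (reflexive (A-nonadjacent x y ¬adj))) (zeroˡ _))
    }

  -- The dual forms

  edge : Matrix D → Fin D → Vertex D → Carrier
  edge B i x = B x (flip i x)

  Δ : Fin D → (Vertex D → Carrier) → Vertex D → Carrier
  Δ j f x = f x - f (flip j x)

  -- Two nested halves make the factor ¼, so that `½#*[x+x]≈x` can remove them one at a time.
  form : Pair D → Matrix D → Carrier
  form (i , j , _) B = ½# * (½# * Δ j (edge B i) 0ⱽ)

  form-linear : ∀ (k : Pair D) → IsLinearForm (matrixSpace D) (form k)
  form-linear k = record
    { ⟦⟧-cong = λ B≈C → *-congˡ (*-congˡ (+-cong (B≈C _ _) (-‿cong (B≈C _ _))))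
    ; +ᴹ-homo = λ B C →
        trans (*-congˡ (trans (*-congˡ (trans (+-congˡ (sym (⁻¹-∙-comm _ _))) (+.interchange _ _ _ _))) (distribˡ _ _ _)))
              (distribˡ _ _ _)
    ; *ₗ-homo = λ c B →
        trans (*-congˡ (trans (*-congˡ (sym (x[y-z]≈xy-xz _ _ _))) (*.x∙yz≈y∙xz _ _ _)))
              (*.x∙yz≈y∙xz _ _ _)
    }

  edge-generator : ∀ k l i (x : Vertex D) → edge (generator k l) i x ≈ wedge k l x (flip i x)
  edge-generator k l i x = trans (generator-entry k l x (flip i x))
    (trans (*-congʳ (reflexive (≡.trans (A-sym x (flip i x)) (A-adjacent (flip i x) x (flip-adjacent i x))))) (*-identityˡ _))

  s-0ⱽ : ∀ (i : Fin D) → s i 0ⱽ ≈ 1#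
  s-0ⱽ i = reflexive (cong sign (lookup-replicate i 0F))

  form-generator-≡ : ∀ {i j : Fin D} (i<j : i < j) → form (i , j , i<j) (generator i j) ≈ 1#
  form-generator-≡ {i = i} {j} i<j = begin
    ½# * (½# * Δ j (edge (generator i j) i) 0ⱽ)    ≈⟨ *-congˡ (*-congˡ (+-cong (value 0ⱽ) (-‿cong (value (flip j 0ⱽ))))) ⟩
    ½# * (½# * (perm i j 0ⱽ 0ⱽ - perm i j (flip j 0ⱽ) (flip j 0ⱽ)))
      ≈⟨ *-congˡ (*-congˡ (+-cong perm-0ⱽ (-‿cong perm-flip))) ⟩
    ½# * (½# * ((1# + 1#) - - (1# + 1#)))          ≈⟨ *-congˡ (*-congˡ (+-congˡ (⁻¹-involutive _))) ⟩
    ½# * (½# * ((1# + 1#) + (1# + 1#)))            ≈⟨ *-congˡ (½#*[x+x]≈x _) ⟩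
    ½# * (1# + 1#)                                 ≈⟨ ½#*[x+x]≈x _ ⟩
    1#                                             ∎
    where
    i≢j = <⇒≢ i<j

    value : ∀ x → edge (generator i j) i x ≈ perm i j x x
    value x = trans (edge-generator i j i x) (wedge-flipʳ i≢j x x)

    perm-0ⱽ : perm i j 0ⱽ 0ⱽ ≈ 1# + 1#
    perm-0ⱽ = +-cong (trans (*-cong (s-0ⱽ i) (s-0ⱽ j)) (*-identityˡ 1#))
                     (trans (*-cong (s-0ⱽ j) (s-0ⱽ i)) (*-identityˡ 1#))

    perm-flip : perm i j (flip j 0ⱽ) (flip j 0ⱽ) ≈ - (1# + 1#)
    perm-flip = begin
      perm i j (flip j 0ⱽ) (flip j 0ⱽ)     ≈⟨ +-cong (*-cong sᵢ sⱼ) (*-cong sⱼ sᵢ) ⟩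
      1# * - 1# + - 1# * 1#                ≈⟨ +-cong (*-identityˡ _) (*-identityʳ _) ⟩
      - 1# - 1#                            ≈⟨ ⁻¹-∙-comm 1# 1# ⟩
      - (1# + 1#)                          ∎
      where
      sᵢ : s i (flip j 0ⱽ) ≈ 1#
      sᵢ = trans (s-flip-≢ i≢j 0ⱽ) (s-0ⱽ i)
      sⱼ : s j (flip j 0ⱽ) ≈ - 1#
      sⱼ = trans (s-flip j 0ⱽ) (-‿cong (s-0ⱽ j))

  form-zero : ∀ (k : Pair D) B → Δ (proj₁ (proj₂ k)) (edge B (proj₁ k)) 0ⱽ ≈ 0# → form k B ≈ 0#
  form-zero k B eq = trans (*-congˡ (trans (*-congˡ eq) (zeroʳ _))) (zeroʳ _)

  -- Coordinates `k` and `l` agree at both ends of an edge in direction `i`, so its entry is a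
  -- determinant with equal rows.
  Δ-generator-∉ˡ : ∀ {i j k l : Fin D} → i ≢ k → i ≢ l → ∀ x → Δ j (edge (generator k l) i) x ≈ 0#
  Δ-generator-∉ˡ {i = i} {j} {k} {l} i≢k i≢l x =
    trans (+-cong (vanish x) (-‿cong (vanish (flip j x)))) (-‿inverseʳ 0#)
    where
    vanish : ∀ x → edge (generator k l) i x ≈ 0#
    vanish x = begin
      edge (generator k l) i x     ≈⟨ edge-generator k l i x ⟩
      wedge k l x (flip i x)       ≈⟨ wedge-cong x (flip i x) x x refl refl (s-flip-≢ (≢-sym i≢k) x) (s-flip-≢ (≢-sym i≢l) x) ⟩
      wedge k l x x                ≈⟨ wedge-diagonal k l x ⟩
      0#                           ∎

  -- Moving the whole edge along `j` leaves coordinates `k` and `l` of both ends unchanged.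
  Δ-generator-∉ʳ : ∀ {i j k l : Fin D} → j ≢ k → j ≢ l → ∀ x → Δ j (edge (generator k l) i) x ≈ 0#
  Δ-generator-∉ʳ {i = i} {j} {k} {l} j≢k j≢l x = trans (+-congˡ (-‿cong invariant)) (-‿inverseʳ _)
    where
    y = flip i x
    invariant : edge (generator k l) i (flip j x) ≈ edge (generator k l) i x
    invariant = begin
      edge (generator k l) i (flip j x)           ≈⟨ edge-generator k l i (flip j x) ⟩
      wedge k l (flip j x) (flip i (flip j x))    ≡⟨ cong (wedge k l (flip j x)) (flip-comm i j x) ⟩
      wedge k l (flip j x) (flip j y)             ≈⟨ wedge-cong (flip j x) (flip j y) x y
        (s-flip-≢ (≢-sym j≢k) x) (s-flip-≢ (≢-sym j≢l) x)
        (s-flip-≢ (≢-sym j≢k) y) (s-flip-≢ (≢-sym j≢l) y) ⟩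
      wedge k l x y                               ≈⟨ edge-generator k l i x ⟨
      edge (generator k l) i x                    ∎

  form-generator-≢ : ∀ {p q : Pair D} → p ≢ q → form p (generator (proj₁ q) (proj₁ (proj₂ q))) ≈ 0#
  form-generator-≢ {p = p@(i , j , i<j)} {k , l , k<l} p≢q with i ≟ k | i ≟ l | j ≟ l
  ... | yes ≡.refl | _          | yes ≡.refl = contradiction (cong (λ r → i , j , r) (<-irrelevant i<j k<l)) p≢q
  ... | yes ≡.refl | _          | no j≢l     = form-zero p (generator i l) (Δ-generator-∉ʳ (≢-sym (<⇒≢ i<j)) j≢l 0ⱽ)
  ... | no i≢k     | no i≢l     | _          = form-zero p (generator k l) (Δ-generator-∉ˡ i≢k i≢l 0ⱽ)
  -- Now k < i < j, so `j` avoids both indices of the generator.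
  ... | no i≢k     | yes ≡.refl | _          = form-zero p (generator k i) (Δ-generator-∉ʳ (≢-sym (<⇒≢ (<-trans k<l i<j))) (≢-sym (<⇒≢ i<j)) 0ⱽ)

  -- Finite differences of an antisymmetric A-like matrix

  Δ-cong : ∀ k {f g : Vertex D → Carrier} → (∀ x → f x ≈ g x) → ∀ x → Δ k f x ≈ Δ k g x
  Δ-cong k eq x = +-cong (eq x) (-‿cong (eq _))

  Δ-neg : ∀ k (f : Vertex D → Carrier) x → Δ k (λ y → - f y) x ≈ - Δ k f x
  Δ-neg k f x = ⁻¹-∙-comm _ _

  Δ-comm : ∀ k l (f : Vertex D → Carrier) x → Δ k (Δ l f) x ≈ Δ l (Δ k f) x
  Δ-comm k l f x = trans (interchange- _ _ _ _)
    (+-congˡ (-‿cong (+-congˡ (-‿cong (reflexive (cong f (flip-comm l k x)))))))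

  Δ-flip : ∀ k (f : Vertex D → Carrier) x → Δ k f (flip k x) ≈ - Δ k f x
  Δ-flip k f x = trans (+-congˡ (-‿cong (reflexive (cong f (flip-involutive k x))))) (sym (⁻¹-anti-homo‿- _ _))

  module _ {B : Matrix D} (antisymmetric : IsAntisymmetric B) (aLike : IsALike B) where
    open IsALike aLike

    private
      b : Fin D → Vertex D → Carrier
      b = edge B

    diagonal≈0 : ∀ x → B x x ≈ 0#
    diagonal≈0 x = x≈-x⇒x≈0 (antisymmetric x x)

    b-flip : ∀ i x → b i (flip i x) ≈ - b i x
    b-flip i x = trans (reflexive (cong (B (flip i x)) (flip-involutive i x))) (antisymmetric x (flip i x))

    sum-commutes : ∀ x y → sum (λ k → B x (flip k y)) ≈ sum (λ k → B (flip k x) y)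
    sum-commutes x y = trans (sym (·A B x y)) (trans (commutes x y) (A· B x y))

    sum-b≈0 : ∀ x → sum (λ k → b k x) ≈ 0#
    sum-b≈0 x = x≈-x⇒x≈0 (begin
      sum (λ k → b k x)            ≈⟨ sum-commutes x x ⟩
      sum (λ k → B (flip k x) x)   ≈⟨ sum-cong-≋ (λ k → antisymmetric x (flip k x)) ⟩
      sum (λ k → - b k x)          ≈⟨ sum-neg (λ k → b k x) ⟩
      - sum (λ k → b k x)          ∎)

    differ-twice≈0 : ∀ {i j} → i ≢ j → ∀ x y → lookup x i ≢ lookup y i → lookup x j ≢ lookup y j → B x y ≈ 0#
    differ-twice≈0 i≢j x y differᵢ differⱼ = support x y (λ { ≡.refl → differᵢ ≡.refl })
      (differ-twice⇒¬Adjacent x y i≢j differᵢ differⱼ)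

    -- Compares BA and AB at the opposite corners of the square spanned by
    -- the directions i and j at x.
    square : ∀ {i j} → i ≢ j → ∀ x → b i x + b j x ≈ b j (flip i x) + b i (flip j x)
    square {i} {j} i≢j x = begin
      b i x + b j x                              ≈⟨ +-comm _ _ ⟩
      b j x + b i x                              ≡⟨ ≡.cong₂ (λ u v → B x u + B x v)
        (≡.sym (flip-involutive i (flip j x)))
        (≡.sym (≡.trans (cong (flip j) (flip-comm i j x)) (flip-involutive j (flip i x)))) ⟩
      B x (flip i y) + B x (flip j y)            ≈⟨ sum-cancel₂ i≢j (λ k → B x (flip k y)) (λ k → B (flip k x) y) off (sum-commutes x y) ⟩
      B (flip i x) y + B (flip j x) y            ≡⟨ cong (λ u → B (flip i x) u + B (flip j x) y) (flip-comm i j x) ⟩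
      b j (flip i x) + b i (flip j x)            ∎
      where
      y = flip i (flip j x)

      yᵢ : lookup y i ≡ opposite (lookup x i)
      yᵢ = ≡.trans (lookup-flip i (flip j x)) (cong opposite (lookup-flip-≢ i≢j x))

      yⱼ : lookup y j ≡ opposite (lookup x j)
      yⱼ = ≡.trans (lookup-flip-≢ (≢-sym i≢j) (flip j x)) (lookup-flip j x)

      differ : ∀ {l} (u v : Vertex D) → lookup u l ≡ lookup x l → lookup v l ≡ opposite (lookup x l) → lookup u l ≢ lookup v l
      differ u v uₗ vₗ eq = opposite-≢ _ (≡.trans (≡.sym vₗ) (≡.trans (≡.sym eq) uₗ))

      -- In any other direction the two vertices still differ at both `i` and `j`, so both entries
      -- lie outside the support.
      off : ∀ k → k ≢ i → k ≢ j → B x (flip k y) ≈ B (flip k x) y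
      off k k≢i k≢j = trans
        (differ-twice≈0 i≢j x (flip k y)
          (differ x (flip k y) ≡.refl (≡.trans (lookup-flip-≢ (≢-sym k≢i) y) yᵢ))
          (differ x (flip k y) ≡.refl (≡.trans (lookup-flip-≢ (≢-sym k≢j) y) yⱼ)))
        (sym (differ-twice≈0 i≢j (flip k x) y
          (differ (flip k x) y (lookup-flip-≢ (≢-sym k≢i) x) yᵢ)
          (differ (flip k x) y (lookup-flip-≢ (≢-sym k≢j) x) yⱼ)))

    Δb-anti : ∀ {i j} → i ≢ j → ∀ x → Δ j (b i) x ≈ - Δ i (b j) x
    Δb-anti i≢j x = transpose- (square i≢j x)

    -- ΔₖΔⱼbᵢ is symmetric in j, k and antisymmetric in i, j.
    ΔΔb≈0 : ∀ {i j k} → i ≢ j → i ≢ k → j ≢ k → ∀ x → Δ k (Δ j (b i)) x ≈ 0#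
    ΔΔb≈0 {i} {j} {k} i≢j i≢k j≢k x = x≈-x⇒x≈0 (begin
      Δ k (Δ j (b i)) x            ≈⟨ exchange i≢j ⟩
      - Δ k (Δ i (b j)) x          ≈⟨ -‿cong (Δ-comm k i (b j) x) ⟩
      - Δ i (Δ k (b j)) x          ≈⟨ -‿cong (exchange j≢k) ⟩
      - - Δ i (Δ j (b k)) x        ≈⟨ -‿cong (-‿cong (Δ-comm i j (b k) x)) ⟩
      - - Δ j (Δ i (b k)) x        ≈⟨ -‿cong (-‿cong (exchange (≢-sym i≢k))) ⟩
      - - - Δ j (Δ k (b i)) x      ≈⟨ ⁻¹-involutive _ ⟩
      - Δ j (Δ k (b i)) x          ≈⟨ -‿cong (Δ-comm j k (b i) x) ⟩
      - Δ k (Δ j (b i)) x          ∎)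
      where
      exchange : ∀ {i j k} → i ≢ j → Δ k (Δ j (b i)) x ≈ - Δ k (Δ i (b j)) x
      exchange {i} {j} {k} i≢j = trans (Δ-cong k (Δb-anti i≢j) x) (Δ-neg k (Δ i (b j)) x)

    -- Along `j` the difference changes sign by definition, along `i` because bᵢ does; along any
    -- other `k` it is constant, since ΔₖΔⱼbᵢ = 0.
    Δb≈0-step : ∀ k x → (∀ i j → i ≢ j → Δ j (b i) x ≈ 0#) → ∀ i j → i ≢ j → Δ j (b i) (flip k x) ≈ 0#
    Δb≈0-step k x Δb≈0 i j i≢j with k ≟ i | k ≟ j
    ... | _          | yes ≡.refl = trans (Δ-flip j (b i) x) (x≈0⇒-x≈0 (Δb≈0 i j i≢j))
    ... | no k≢i     | no k≢j     = trans
      (sym (x∙y⁻¹≈ε⇒x≈y _ _ (ΔΔb≈0 i≢j (≢-sym k≢i) (≢-sym k≢j) x))) (Δb≈0 i j i≢j)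
    ... | yes ≡.refl | no _       = begin
      b i (flip i x) - b i (flip j (flip i x))    ≡⟨ cong (λ u → b i (flip i x) - b i u) (flip-comm j i x) ⟩
      b i (flip i x) - b i (flip i (flip j x))    ≈⟨ +-cong (b-flip i x) (-‿cong (b-flip i (flip j x))) ⟩
      Δ j (λ y → - b i y) x                       ≈⟨ Δ-neg j (b i) x ⟩
      - Δ j (b i) x                               ≈⟨ x≈0⇒-x≈0 (Δb≈0 i j i≢j) ⟩
      0#                                          ∎

    module _ (form≈0 : ∀ k → form k B ≈ 0#) where

      Δb≈0 : ∀ x i j → i ≢ j → Δ j (b i) x ≈ 0#
      Δb≈0 = flip-induction _ base Δb≈0-step
        where
        base-< : ∀ {i j} → i < j → Δ j (b i) 0ⱽ ≈ 0#
        base-< i<j = ½#*x≈0⇒x≈0 (½#*x≈0⇒x≈0 (form≈0 (_ , _ , i<j)))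

        base : ∀ i j → i ≢ j → Δ j (b i) 0ⱽ ≈ 0#
        base i j i≢j with <-cmp i j
        ... | tri< i<j _ _ = base-< i<j
        ... | tri≈ _ i≡j _ = contradiction i≡j i≢j
        -- The forms cover only increasing pairs; antisymmetry in the indices supplies the others.
        ... | tri> _ _ j<i = trans (Δb-anti i≢j 0ⱽ) (x≈0⇒-x≈0 (base-< j<i))

      -- Passing from x to flip i x changes only the i-th term of the
      -- vanishing sum Σₖ bₖ, and that term changes sign.
      b≈0 : ∀ i x → b i x ≈ 0#
      b≈0 i x = x≈-x⇒x≈0 (trans
        (sum-cancel₁ i (λ k → b k x) (λ k → b k (flip i x)) (λ k k≢i → x∙y⁻¹≈ε⇒x≈y _ _ (Δb≈0 x k i k≢i))
          (trans (sum-b≈0 x) (sym (sum-b≈0 (flip i x)))))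
        (b-flip i x))

      separating : B ≈ₘ 0ₘ
      -- Testing `y` against `x` expresses `y` as a flip of `x`, which is the shape of `edge`.
      separating x y with x ≟ⱽ y | adjacent? y x
      ... | yes ≡.refl | _       = diagonal≈0 x
      ... | no _       | yes adj = trans (reflexive (cong (B x) (adjacent⇒flip y x adj))) (b≈0 _ x)
      ... | no x≢y     | no ¬adj = support x y x≢y (¬adj ∘ Adjacent-sym x y)

  -- The basis and the dimension

  generatorAt : Pair D → Matrix D
  generatorAt (i , j , _) = generator i j

  module _ (D : ℕ) where
    private
      W = antisymmetricALike D
      open Inverse (Fin↔Pair D) using (to; from; strictlyInverseˡ)
      open Injection (↔⇒↣ (Fin↔Pair D)) using (injective)

      complete : ∀ (k : Pair D) → k ∈ map to (allFin (D C 2))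
      complete k = subst (_∈ map to (allFin (D C 2))) (strictlyInverseˡ k) (∈-map⁺ to (∈-allFin (from k)))

    generators-basis : IsBasis W generatorAt
    generators-basis = DualBasis.isBasis W generatorAt form form-linear
      (λ (_ , _ , i<j) → form-generator-≡ i<j) form-generator-≢
      (map to (allFin (D C 2))) (map⁺ injective (allFin⁺ (D C 2))) complete
      (λ (_ , _ , i<j) → generator-member (<⇒≢ i<j))
      (λ (anti , aLike) → separating anti aLike)

    -- A dimension is witnessed by a family indexed by `Fin`, so the generators and their forms are
    -- both reindexed along `Fin↔Pair`.
    dimension : HasDimension W (D C 2)
    dimension = generatorAt ∘ to , DualBasis.isBasis W (generatorAt ∘ to) (form ∘ to) (form-linear ∘ to)
      (λ k → form-generator-≡ (proj₂ (proj₂ (to k)))) (λ k≢l → form-generator-≢ (k≢l ∘ injective))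
      (allFin (D C 2)) (allFin⁺ (D C 2)) ∈-allFin
      (λ k → generator-member (<⇒≢ (proj₂ (proj₂ (to k)))))
      (λ {B} (anti , aLike) form≈0 → separating anti aLike λ k →
        subst (λ l → form l B ≈ 0#) (strictlyInverseˡ k) (form≈0 (from k)))

open Defs

theorem9p7 : (D : ℕ) → 1 ≤ D →
    IsBasis (antisymmetricALike D) {I = ∃₂ λ (i j : Fin D) → i < j} (λ (i , j , _) → α* i · A · α* j -ₘ α* j · A · α* i)
    × HasDimension (antisymmetricALike D) (D C 2)
theorem9p7 D _ = generators-basis D , dimension D
  -- The constant sequences for ½ + ½ and 1 agree term by term, by computation in the rationals.
  where open AntisymmetricALike ℝ-commutativeRing (fromℚ ½) (≗⇒≈ λ _ → ≡.refl)
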